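{- If $M$ is a $\lambda\mu I$-term, then a standard reduction sequence starting from $M$ and leading to the normal form of $M$ is the leftmost reduction sequence, and it is a reduction sequence of maximal length (among the reduction sequences starting from $M$).
   Context: Terms are generated from $\lambda$-variables $x,y,\dots$ and $\mu$-variables $\alpha,\beta,\dots$ by $\mathcal T::=x\mid \lambda x.\mathcal T\mid\mu\alpha.\mathcal T\mid[\alpha]\mathcal T\mid(\mathcal T\,\mathcal T)$, modulo renaming of bound variables; application associates to the left. $comp(x)=1$, $comp([\alpha]M)=comp(\lambda x.M)=comp(\mu\alpha.M)=comp(M)+1$, $comp(M\,N)=comp(M)+comp(N)$. Types: built from atomic types and $\bot$ with $\to$; $\neg A$ is $A\to\bot$. Typing: $\Gamma,x:A\vdash x:A$; $\Gamma,x:A\vdash M:B$ gives $\Gamma\vdash\lambda x.M:A\to B$; $\Gamma\vdash M:A\to B$, $\Gamma\vdash N:A$ give $\Gamma\vdash M\,N:B$; $\Gamma,\alpha:\neg A\vdash M:A$ gives $\Gamma,\alpha:\neg A\vdash[\alpha]M:\bot$; $\Gamma,\alpha:\neg A\vdash M:\bot$ gives $\Gamma\vdash\mu\alpha.M:A$. All terms considered are typable (hence strongly normalizing, with a unique normal form). Reduction rules: $(\lambda x.M)N\to_\beta M[x:=N]$; $(\mu\alpha.M)N\to_\mu\mu\alpha.M[\alpha:=_rN]$, where $[\alpha:=_rN]$ (recursively) replaces each subterm $[\alpha]U$ ($\alpha$ free) by $[\alpha](U\,N)$; $[\alpha]\mu\beta.M\to_\rho M[\beta:=\alpha]$; $\mu\alpha.[\alpha]M\to_\theta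 M$ if $\alpha\notin Fv(M)$. $M\mapsto^\sigma N$: $\sigma=[R_1,\dots,R_n]$ is a sequence of contracted redex occurrences leading from $M$ to $N$, $|\sigma|=n$; $\#$ is concatenation. $NF$ is the set of terms without redexes. $\lambda\mu I$-terms: variables; $(M\,N)$ and $[\alpha]M$ for $\lambda\mu I$-terms $M,N$; $\lambda x.M$ for a $\lambda\mu I$-term $M$ with $x\in Fv(M)$; $\mu\alpha.M$ for a $\lambda\mu I$-term $M$ with $\alpha\in Fv(M)$. Leftmost redex $lr(M)$ (undefined in cases not listed): $lr(\lambda x.M)=lr(M)$; $lr(\mu\alpha.M)=\mu\alpha.M$ if this is a $\theta$-redex, else $lr(M)$; $lr([\alpha]M)=[\alpha]M$ if this is a $\rho$-redex, else $lr(M)$; $lr((\mu\alpha.M_1)M_2\vec P)=(\mu\alpha.M_1)M_2$; $lr((\lambda x.M_1)M_2\vec P)=(\lambda x.M_1)M_2$; $lr(x\,M_1\dots M_n)=lr(M_i)$ if $M_i\notin NF$ and $M_j\in NF$ for $j<i$. A reduction sequence is leftmost if each step contracts the leftmost redex. Standard sequences (recursion on $(|\sigma|,comp(M))$, lexicographically). $M\mapsto^\sigma N$ is standard if it is empty or one of the following holds. (1) $M=\lambda x.M_1$, $N=\lambda x.N_1$, $M_1\mapsto^\sigma N_1$ is standard. (2) $M=\mu\alpha.M_1$, with $\sigma$ being $M=P_1\to\cdots\to P_{k+1}=N$, and either (a) $N=\mu\alpha.N_1$, $M_1\mapsto^\sigma N_1$ is standard and no $P_j$ is a $\theta$-redex;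 or (b) $P_j=\mu\alpha.[\alpha]M'$ is the first $P_j$ that is a $\theta$-redex, the initial part $\sigma'$ of $\sigma$ up to $P_j$ is standard (as a sequence $M_1\mapsto^{\sigma'}[\alpha]M'$), and the rest is either (i) $P_j\to_\theta M'\mapsto^{\sigma''}N$ with $\sigma''$ standard, or (ii) $P_j\mapsto^{\sigma'''}\mu\alpha.[\alpha]N'=N$ with $M'\mapsto^{\sigma'''}N'$ standard. (3) $M=[\alpha]M_1$, with $\sigma$ being $M=P_1\to\cdots\to P_{k+1}=N$, and either (a) $N=[\alpha]N_1$, $M_1\mapsto^\sigma N_1$ is standard and no $P_j$ is a $\rho$-redex; or (b) $P_j=[\alpha]\mu\beta.M'$ is the first $P_j$ that is a $\rho$-redex, the initial part $\sigma'$ of $\sigma$ up to $P_j$ is standard (as a sequence $M_1\mapsto^{\sigma'}\mu\beta.M'$), and the rest is either (i) $P_j\to_\rho M'[\beta:=\alpha]\mapsto^{\sigma''}N$ with $\sigma''$ standard, or (ii) $P_j\mapsto^{\sigma'''}[\alpha]\mu\beta.N'=N$ with $M'\mapsto^{\sigma'''}N'$ standard. (4) $M=(\lambda x.M_1)M_2\dots M_n$ ($n\ge2$) and either (a) $M\to_\beta(M_1[x:=M_2]\,M_3\dots M_n)\mapsto^{\sigma_1}N$ with $\sigma_1$ standard, or (b) $N=(\lambda x.N_1)N_2\dots N_n$ and $\sigma=\sigma_1\#\cdots\#\sigma_n$ with $\lambda x.M_1\mapsto^{\sigma_1}\lambda x.N_1$ and $M_i\mapsto^{\sigma_i}N_i$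 ($i\ge2$) standard. (5) $M=(\mu\alpha.M_1)M_2\dots M_n$ ($n\ge2$) and either (a) $M\to_\mu(\mu\alpha.M_1[\alpha:=_rM_2])M_3\dots M_n\mapsto^{\sigma_1}N$ with $\sigma_1$ standard, or (b) $N=(\mu\alpha.N_1)N_2\dots N_n$ and $\sigma=\sigma_1\#\cdots\#\sigma_n$ with $\mu\alpha.M_1\mapsto^{\sigma_1}\mu\alpha.N_1$ (the prefix $\mu\alpha$ being kept, i.e. never contracted as a $\theta$-redex) and $M_i\mapsto^{\sigma_i}N_i$ ($i\ge2$) standard. (6) $M=(x\,M_1\dots M_n)$, $N=(x\,N_1\dots N_n)$, $\sigma=\sigma_1\#\cdots\#\sigma_n$ with $M_i\mapsto^{\sigma_i}N_i$ standard. -}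

module Defs where

open import Data.Fin using (Fin; zero; suc; _≟_)
open import Data.List using (List; []; _∷_; foldl)
open import Data.List.Relation.Binary.Pointwise using (Pointwise; []; _∷_)
open import Data.List.Relation.Unary.All using (All)
open import Data.Nat using (ℕ; zero; suc)
open import Data.Product using (∃; ∃₂; _×_)
open import Data.Unit using (⊤)
open import Data.Vec using (Vec; _∷_; lookup)
open import Function using (id; _∘_)
open import Relation.Binary.Construct.Closure.ReflexiveTransitive
  using (Star; ε; _◅_; _◅◅_; gmap)
open import Relation.Binary.PropositionalEquality using (_≡_)
open import Relation.Nullary using (¬_; yes; no)

-- Terms up to renaming of bound variables: well-scoped de Bruijn terms with
-- two independent index spaces.  In  Tm l m  the free λ-variables are among
-- Fin l  and the free μ-variables among  Fin m.

infixl 7 _·_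

data Tm (l m : ℕ) : Set where
  var : Fin l → Tm l m
  ƛ_  : Tm (suc l) m → Tm l m
  μ_  : Tm l (suc m) → Tm l m
  ⟦_⟧_ : Fin m → Tm l m → Tm l m
  _·_ : Tm l m → Tm l m → Tm l m

infixr 6 ƛ_ μ_ ⟦_⟧_

data _∈Fvλ_ {l m : ℕ} (x : Fin l) : Tm l m → Set
data _∈Fvμ_ {l m : ℕ} (α : Fin m) : Tm l m → Set

data _∈Fvλ_ {l} {m} x where
  fv-var  : x ∈Fvλ var x
  fv-ƛ    : ∀ {M : Tm (suc l) m} → suc x ∈Fvλ M → x ∈Fvλ (ƛ M)
  fv-μ    : ∀ {M : Tm l (suc m)} → x ∈Fvλ M → x ∈Fvλ (μ M)
  fv-⟦⟧   : ∀ {β} {M : Tm l m} → x ∈Fvλ M → x ∈Fvλ (⟦ β ⟧ M)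
  fv-appˡ : ∀ {M N : Tm l m} → x ∈Fvλ M → x ∈Fvλ (M · N)
  fv-appʳ : ∀ {M N : Tm l m} → x ∈Fvλ N → x ∈Fvλ (M · N)

data _∈Fvμ_ {l} {m} α where
  fv-name : ∀ {M : Tm l m} → α ∈Fvμ (⟦ α ⟧ M)
  fv-⟦⟧   : ∀ {β} {M : Tm l m} → α ∈Fvμ M → α ∈Fvμ (⟦ β ⟧ M)
  fv-ƛ    : ∀ {M : Tm (suc l) m} → α ∈Fvμ M → α ∈Fvμ (ƛ M)
  fv-μ    : ∀ {M : Tm l (suc m)} → suc α ∈Fvμ M → α ∈Fvμ (μ M)
  fv-appˡ : ∀ {M N : Tm l m} → α ∈Fvμ M → α ∈Fvμ (M · N)
  fv-appʳ : ∀ {M N : Tm l m} → α ∈Fvμ N → α ∈Fvμ (M · N)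

data λμI {l m : ℕ} : Tm l m → Set where
  I-var : ∀ x → λμI (var x)
  I-ƛ   : ∀ {M : Tm (suc l) m} → λμI M → zero ∈Fvλ M → λμI (ƛ M)
  I-μ   : ∀ {M : Tm l (suc m)} → λμI M → zero ∈Fvμ M → λμI (μ M)
  I-⟦⟧  : ∀ {α} {M : Tm l m} → λμI M → λμI (⟦ α ⟧ M)
  I-app : ∀ {M N : Tm l m} → λμI M → λμI N → λμI (M · N)

infixr 5 _⇒_
infix 6 ¬̇_

data Ty : Set where
  atom : ℕ → Ty
  ⊥̇    : Ty
  _⇒_  : Ty → Ty → Ty

¬̇_ : Ty → Ty
¬̇ A = A ⇒ ⊥̇

infix 3 _∣_⊢_∶_

-- Γ declares the λ-variables and Δ the μ-variables.
data _∣_⊢_∶_ {l m : ℕ} (Γ : Vec Ty l) (Δ : Vec Ty m) : Tm l m → Ty → Set where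
  ⊢var : ∀ {x A} → lookup Γ x ≡ A → Γ ∣ Δ ⊢ var x ∶ A
  ⊢ƛ   : ∀ {M A B} → (A ∷ Γ) ∣ Δ ⊢ M ∶ B → Γ ∣ Δ ⊢ ƛ M ∶ A ⇒ B
  ⊢app : ∀ {M N A B} → Γ ∣ Δ ⊢ M ∶ A ⇒ B → Γ ∣ Δ ⊢ N ∶ A → Γ ∣ Δ ⊢ M · N ∶ B
  ⊢⟦⟧  : ∀ {α M A} → lookup Δ α ≡ ¬̇ A → Γ ∣ Δ ⊢ M ∶ A → Γ ∣ Δ ⊢ ⟦ α ⟧ M ∶ ⊥̇
  ⊢μ   : ∀ {M A} → Γ ∣ (¬̇ A ∷ Δ) ⊢ M ∶ ⊥̇ → Γ ∣ Δ ⊢ μ M ∶ A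

ext : ∀ {k n} → (Fin k → Fin n) → Fin (suc k) → Fin (suc n)
ext ρ zero    = zero
ext ρ (suc i) = suc (ρ i)

rename : ∀ {l m l′ m′} → (Fin l → Fin l′) → (Fin m → Fin m′) → Tm l m → Tm l′ m′
rename ρ π (var x)     = var (ρ x)
rename ρ π (ƛ M)       = ƛ rename (ext ρ) π M
rename ρ π (μ M)       = μ rename ρ (ext π) M
rename ρ π (⟦ α ⟧ M)   = ⟦ π α ⟧ rename ρ π M
rename ρ π (M · N)     = rename ρ π M · rename ρ π N

wkλ : ∀ {l m} → Tm l m → Tm (suc l) m
wkλ = rename suc id

-- The terms of  Tm l (suc m)  in which μ-variable zero is not free are exactly
-- those of the form  wkμ M.
wkμ : ∀ {l m} → Tm l m → Tm l (suc m)
wkμ = rename id suc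

extS : ∀ {l l′ m} → (Fin l → Tm l′ m) → Fin (suc l) → Tm (suc l′) m
extS s zero    = var zero
extS s (suc x) = wkλ (s x)

sub : ∀ {l l′ m} → (Fin l → Tm l′ m) → Tm l m → Tm l′ m
sub s (var x)   = s x
sub s (ƛ M)     = ƛ sub (extS s) M
sub s (μ M)     = μ sub (wkμ ∘ s) M
sub s (⟦ α ⟧ M) = ⟦ α ⟧ sub s M
sub s (M · N)   = sub s M · sub s N

_[_] : ∀ {l m} → Tm (suc l) m → Tm l m → Tm l m
_[_] {l} {m} M N = sub s M
  where
  s : Fin (suc l) → Tm l m
  s zero    = N
  s (suc x) = var x

_[_≔ᵣ_] : ∀ {l m} → Tm l m → Fin m → Tm l m → Tm l m
var x     [ α ≔ᵣ N ] = var x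
(ƛ M)     [ α ≔ᵣ N ] = ƛ (M [ α ≔ᵣ wkλ N ])
(μ M)     [ α ≔ᵣ N ] = μ (M [ suc α ≔ᵣ wkμ N ])
(⟦ β ⟧ U) [ α ≔ᵣ N ] with β ≟ α
... | yes _ = ⟦ β ⟧ ((U [ α ≔ᵣ N ]) · N)
... | no  _ = ⟦ β ⟧ (U [ α ≔ᵣ N ])
(P · Q)   [ α ≔ᵣ N ] = (P [ α ≔ᵣ N ]) · (Q [ α ≔ᵣ N ])

-- M [β := α] for the μ-variable β bound at index zero.
_[≔_] : ∀ {l m} → Tm l (suc m) → Fin m → Tm l m
_[≔_] {l} {m} M α = rename id π M
  where
  π : Fin (suc m) → Fin m
  π zero    = α
  π (suc β) = β

infix 3 _⟶_ _↠_

-- One-step reduction is proof-relevant: an element of  M ⟶ N  locates the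
-- contracted redex occurrence in M.
data _⟶_ {l m : ℕ} : Tm l m → Tm l m → Set where
  β-red : ∀ M N → (ƛ M) · N ⟶ M [ N ]
  μ-red : ∀ M N → (μ M) · N ⟶ μ (M [ zero ≔ᵣ wkμ N ])
  ρ-red : ∀ α M → ⟦ α ⟧ μ M ⟶ M [≔ α ]
  θ-red : ∀ M → μ ⟦ zero ⟧ wkμ M ⟶ M
  ξƛ : ∀ {M M′} → M ⟶ M′ → ƛ M ⟶ ƛ M′
  ξμ : ∀ {M M′} → M ⟶ M′ → μ M ⟶ μ M′
  ξ⟦⟧ : ∀ {α M M′} → M ⟶ M′ → ⟦ α ⟧ M ⟶ ⟦ α ⟧ M′
  ξˡ : ∀ {M M′ N} → M ⟶ M′ → M · N ⟶ M′ · N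
  ξʳ : ∀ {M N N′} → N ⟶ N′ → M · N ⟶ M · N′

NF : ∀ {l m} → Tm l m → Set
NF M = ∀ {N} → ¬ (M ⟶ N)

θRedex : ∀ {l m} → Tm l m → Set
θRedex P = ∃ λ M → P ≡ μ ⟦ zero ⟧ wkμ M

ρRedex : ∀ {l m} → Tm l m → Set
ρRedex P = ∃₂ λ α M → P ≡ ⟦ α ⟧ μ M

_↠_ : ∀ {l m} → Tm l m → Tm l m → Set
_↠_ = Star _⟶_

∣_∣ : ∀ {l m} {M N : Tm l m} → M ↠ N → ℕ
∣ ε ∣     = 0
∣ _ ◅ σ ∣ = suc ∣ σ ∣

-- For σ : P₁ → ⋯ → P_{k+1}: the predicate holds of all the P_j.
Throughout : ∀ {l m} (X : Tm l m → Set) {M N : Tm l m} → M ↠ N → Set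
Throughout X {M} ε       = X M
Throughout X {M} (_ ◅ σ) = X M × Throughout X σ

-- The same, for all the P_j except the last.
BeforeLast : ∀ {l m} (X : Tm l m → Set) {M N : Tm l m} → M ↠ N → Set
BeforeLast X     ε       = ⊤
BeforeLast X {M} (_ ◅ σ) = X M × BeforeLast X σ

ƛ* : ∀ {l m} {M N : Tm (suc l) m} → M ↠ N → ƛ M ↠ ƛ N
ƛ* = gmap ƛ_ ξƛ

μ* : ∀ {l m} {M N : Tm l (suc m)} → M ↠ N → μ M ↠ μ N
μ* = gmap μ_ ξμ

⟦_⟧* : ∀ {l m} (α : Fin m) {M N : Tm l m} → M ↠ N → ⟦ α ⟧ M ↠ ⟦ α ⟧ N
⟦ α ⟧* = gmap ⟦ α ⟧_ ξ⟦⟧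

infixl 7 _·*_ _·ˢ_ _·**_

_·*_ : ∀ {l m} → Tm l m → List (Tm l m) → Tm l m
M ·* Ps = foldl _·_ M Ps

_·ˢ_ : ∀ {l m} {M M′ : Tm l m} → M ⟶ M′ → ∀ Ps → M ·* Ps ⟶ M′ ·* Ps
s ·ˢ []       = s
s ·ˢ (P ∷ Ps) = ξˡ s ·ˢ Ps

-- σ₁ # σ₂ # ⋯ # σₙ : first the head is reduced, then the arguments from left
-- to right.
_·**_ : ∀ {l m} {H H′ : Tm l m} {Ms Ns} →
        H ↠ H′ → Pointwise _↠_ Ms Ns → H ·* Ms ↠ H′ ·* Ns
σ ·** [] = σ
_·**_ {H′ = H′} σ (_∷_ {x = M} τ τs) =
  (gmap (_· M) ξˡ σ ◅◅ gmap (H′ ·_) ξʳ τ) ·** τs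

-- LR s  says that the occurrence contracted by  s : M ⟶ N  is lr(M).
data LR {l m : ℕ} : {M N : Tm l m} → M ⟶ N → Set where
  lr-ƛ   : ∀ {M N} {s : M ⟶ N} → LR s → LR (ξƛ s)
  lr-θ   : ∀ M → LR (θ-red M)
  lr-μ   : ∀ {M N} {s : M ⟶ N} → ¬ θRedex (μ M) → LR s → LR (ξμ s)
  lr-ρ   : ∀ α M → LR (ρ-red α M)
  lr-⟦⟧  : ∀ {α M N} {s : M ⟶ N} → ¬ ρRedex (⟦ α ⟧ M) → LR s → LR (ξ⟦⟧ {α = α} s)
  lr-μ·  : ∀ M₁ M₂ Ps → LR (μ-red M₁ M₂ ·ˢ Ps)
  lr-β   : ∀ M₁ M₂ Ps → LR (β-red M₁ M₂ ·ˢ Ps)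
  lr-var : ∀ x {Ms M N} {s : M ⟶ N} Ps → All NF Ms → LR s →
           LR (ξʳ {M = var x ·* Ms} s ·ˢ Ps)

data Leftmost {l m : ℕ} {N : Tm l m} : {M : Tm l m} → M ↠ N → Set where
  ε   : Leftmost ε
  _◅_ : ∀ {M M′} {s : M ⟶ M′} {σ : M′ ↠ N} → LR s → Leftmost σ → Leftmost (s ◅ σ)

data Standard {l m : ℕ} : {M N : Tm l m} → M ↠ N → Set

data Standards {l m : ℕ} : {Ms Ns : List (Tm l m)} → Pointwise _↠_ Ms Ns → Set where
  []  : Standards []
  _∷_ : ∀ {M N Ms Ns} {σ : M ↠ N} {σs : Pointwise _↠_ Ms Ns} →
        Standard σ → Standards σs → Standards (σ ∷ σs)

data Standard {l} {m} where
  st-ε : ∀ {M} → Standard (ε {x = M})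

  st-ƛ : ∀ {M₁ N₁} {σ : M₁ ↠ N₁} → Standard σ → Standard (ƛ* σ)

  -- A prefix μα (resp. [α]) can be contracted only in a term that is itself a
  -- θ-redex (resp. ρ-redex); before the first such term all steps take place
  -- under the prefix.
  st-μ : ∀ {M₁ N₁} {σ : M₁ ↠ N₁} →
         Standard σ → Throughout (λ P → ¬ θRedex P) (μ* σ) →
         Standard (μ* σ)
  st-μ-θ : ∀ {M₁ M′ N} {σ′ : M₁ ↠ ⟦ zero ⟧ wkμ M′} {σ″ : M′ ↠ N} →
           BeforeLast (λ P → ¬ θRedex P) (μ* σ′) → Standard σ′ → Standard σ″ →
           Standard (μ* σ′ ◅◅ (θ-red M′ ◅ σ″))
  -- M′ is kept in the scope of the binder, where it has the form  wkμ M″.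
  st-μ-noθ : ∀ {M₁ M′ N′} {σ′ : M₁ ↠ ⟦ zero ⟧ M′} {σ‴ : M′ ↠ N′} →
             BeforeLast (λ P → ¬ θRedex P) (μ* σ′) → θRedex (μ ⟦ zero ⟧ M′) →
             Standard σ′ → Standard σ‴ →
             Standard (μ* σ′ ◅◅ μ* (⟦ zero ⟧* σ‴))

  st-⟦⟧ : ∀ {α M₁ N₁} {σ : M₁ ↠ N₁} →
          Standard σ → Throughout (λ P → ¬ ρRedex P) (⟦ α ⟧* σ) →
          Standard (⟦ α ⟧* σ)
  st-⟦⟧-ρ : ∀ {α M₁ M′ N} {σ′ : M₁ ↠ μ M′} {σ″ : M′ [≔ α ] ↠ N} →
            BeforeLast (λ P → ¬ ρRedex P) (⟦ α ⟧* σ′) → Standard σ′ → Standard σ″ →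
            Standard (⟦ α ⟧* σ′ ◅◅ (ρ-red α M′ ◅ σ″))
  st-⟦⟧-noρ : ∀ {α M₁ M′ N′} {σ′ : M₁ ↠ μ M′} {σ‴ : M′ ↠ N′} →
              BeforeLast (λ P → ¬ ρRedex P) (⟦ α ⟧* σ′) → Standard σ′ → Standard σ‴ →
              Standard (⟦ α ⟧* σ′ ◅◅ ⟦ α ⟧* (μ* σ‴))

  st-β : ∀ {M₁ M₂ Ms N} {σ₁ : M₁ [ M₂ ] ·* Ms ↠ N} →
         Standard σ₁ → Standard ((β-red M₁ M₂ ·ˢ Ms) ◅ σ₁)
  st-noβ : ∀ {M₁ N₁ M₂ N₂ Ms Ns} {σ₁ : ƛ M₁ ↠ ƛ N₁}
           {σs : Pointwise _↠_ (M₂ ∷ Ms) (N₂ ∷ Ns)} →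
           Standard σ₁ → Standards σs → Standard (σ₁ ·** σs)

  st-μ· : ∀ {M₁ M₂ Ms N} {σ₁ : (μ (M₁ [ zero ≔ᵣ wkμ M₂ ])) ·* Ms ↠ N} →
          Standard σ₁ → Standard ((μ-red M₁ M₂ ·ˢ Ms) ◅ σ₁)
  -- The head sequence has the form  μ* σ₁, so it never contracts the prefix.
  st-noμ· : ∀ {M₁ N₁ M₂ N₂ Ms Ns} {σ₁ : M₁ ↠ N₁}
            {σs : Pointwise _↠_ (M₂ ∷ Ms) (N₂ ∷ Ns)} →
            Standard (μ* σ₁) → Standards σs → Standard (μ* σ₁ ·** σs)

  st-var : ∀ {x Ms Ns} {σs : Pointwise _↠_ Ms Ns} →
           Standards σs → Standard (ε {x = var x} ·** σs)

{-# OPTIONS --safe #-}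

-- For λμI-terms no contraction erases a redex, so a step  M ⟶ M′  can be
-- postponed after the leftmost step  M ⟶ L:  either  L ↠ M′, or M′ has a leftmost
-- step to some L′ with at least one step from L to L′.  By induction on the length
-- of the leftmost sequence from M to its normal form, every step strictly decreases
-- that length, which therefore bounds all reductions from M.
--
-- A standard sequence to a normal form cannot pass over the leftmost redex, which it
-- would then never contract.  Where it first works inside  μα.M₁  or  [α]M₁  until a
-- θ- or ρ-redex appears at the root, that redex can only be produced by contractions
-- at the root of the body (steps further inside keep the free variables), hence this
-- part is leftmost too.
module Submission where

open import Data.Fin using (Fin; zero; suc; _≟_)
open import Data.Fin.Properties using (suc-injective)
open import Data.List using (List; []; _∷_; _++_; map)
open import Data.List.Properties using (++-identityʳ; foldl-++; map-++; map-∘; map-cong; map-id)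
open import Data.List.Relation.Binary.Pointwise using (Pointwise; []; _∷_)
open import Data.List.Relation.Unary.All using (All; []; _∷_)
import Data.List.Relation.Unary.All as All
import Data.List.Relation.Unary.All.Properties as All
open import Data.List.Relation.Unary.Any using (Any; here; there)
import Data.List.Relation.Unary.Any as Any
import Data.List.Relation.Unary.Any.Properties as Any
open import Data.Nat using (ℕ; zero; suc; _≤_; _<_; z≤n; s≤s)
open import Data.Nat.Properties using (≤-refl; ≤-trans; <⇒≤; ≤-<-trans)
open import Data.Product using (∃; _×_; _,_; proj₂)
open import Data.Sum using (_⊎_; inj₁; inj₂)
import Data.Sum as Sum
open import Data.Vec using (Vec)
open import Function using (id; _∘_)
open import Relation.Binary.Construct.Closure.ReflexiveTransitive using (ε; _◅_; _◅◅_; gmap)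
open import Relation.Binary.PropositionalEquality
  using (_≡_; _≢_; _≗_; refl; sym; trans; cong; cong₂; subst; module ≡-Reasoning)
open import Relation.Nullary using (¬_; yes; no; contradiction)
open import Defs

-- A step and the leftmost step commute only up to the number of steps. A step survives substitution
-- as a nonempty sequence: copying multiplies it, and a ρ-redex `[α]μβ.M` becomes
-- `[α]((μβ.M) P₁ ⋯ Pₙ)` when α carries a stack, so n μ-steps must come before the ρ-step. The count
-- therefore uses nothing but nonemptiness. When `L ↠ M′`, the leftmost step of M itself pays for
-- the decrease; otherwise M′ still owes a leftmost step, and the nonempty sequence from L to L′
-- pays for it. The first alternative also absorbs the critical pairs: μ over θ, θ over ρ and ρ over
-- θ all close without a leftmost step of M′. Since a leftmost step under a prefix requires that the
-- prefix is not itself a redex, this side condition has to be carried over to M′. It fails there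
-- only if the step creates a redex at the prefix, and such a step turns out to be the leftmost one.
-- The same fact, iterated along a sequence, handles the initial parts of standard sequences.

private variable
  k n l l′ l″ m m′ m″ : ℕ

-- Parallel substitution: x is replaced by  tm x  and a subterm  [α]U  by
-- [name α](U P₁ ⋯ Pₙ)  with  stk α = P₁, …, Pₙ.  Renamings, λ-substitutions and
-- structural substitutions are instances, so that a single composition law
-- replaces all their commutation lemmas.
record Subst (l m l′ m′ : ℕ) : Set where
  constructor ⟨_,_,_⟩
  field
    tm   : Fin l → Tm l′ m′
    name : Fin m → Fin m′
    stk  : Fin m → List (Tm l′ m′)

open Subst

infix 4 _≈_
record _≈_ (d e : Subst l m l′ m′) : Set where
  constructor ⟨_,_,_⟩
  field
    tm≈   : tm d ≗ tm e
    name≈ : name d ≗ name e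
    stk≈  : stk d ≗ stk e

open _≈_

extK : (Fin m → List (Tm l′ m′)) → Fin (suc m) → List (Tm l′ (suc m′))
extK κ zero    = []
extK κ (suc α) = map wkμ (κ α)

↑λ : Subst l m l′ m′ → Subst (suc l) m (suc l′) m′
↑λ e = ⟨ extS (tm e) , name e , map wkλ ∘ stk e ⟩

↑μ : Subst l m l′ m′ → Subst l (suc m) l′ (suc m′)
↑μ e = ⟨ wkμ ∘ tm e , ext (name e) , extK (stk e) ⟩

inst : Subst l m l′ m′ → Tm l m → Tm l′ m′
inst e (var x)   = tm e x
inst e (ƛ M)     = ƛ inst (↑λ e) M
inst e (μ M)     = μ inst (↑μ e) M
inst e (⟦ α ⟧ M) = ⟦ name e α ⟧ (inst e M ·* stk e α)
inst e (M · N)   = inst e M · inst e N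

≈-trans : {c d e : Subst l m l′ m′} → c ≈ d → d ≈ e → c ≈ e
≈-trans ⟨ p , q , r ⟩ ⟨ p′ , q′ , r′ ⟩ =
  ⟨ (λ x → trans (p x) (p′ x)) , (λ x → trans (q x) (q′ x)) , (λ x → trans (r x) (r′ x)) ⟩

ext-cong : {ρ π : Fin k → Fin n} → ρ ≗ π → ext ρ ≗ ext π
ext-cong p zero    = refl
ext-cong p (suc x) = cong suc (p x)

↑λ-cong : {d e : Subst l m l′ m′} → d ≈ e → ↑λ d ≈ ↑λ e
↑λ-cong {d = d} {e} ⟨ p , q , r ⟩ = ⟨ tm′ , q , cong (map wkλ) ∘ r ⟩
  where
  tm′ : extS (tm d) ≗ extS (tm e)
  tm′ zero    = refl
  tm′ (suc x) = cong wkλ (p x)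

↑μ-cong : {d e : Subst l m l′ m′} → d ≈ e → ↑μ d ≈ ↑μ e
↑μ-cong {d = d} {e} ⟨ p , q , r ⟩ = ⟨ cong wkμ ∘ p , ext-cong q , stk′ ⟩
  where
  stk′ : extK (stk d) ≗ extK (stk e)
  stk′ zero    = refl
  stk′ (suc α) = cong (map wkμ) (r α)

inst-cong : {d e : Subst l m l′ m′} → d ≈ e → inst d ≗ inst e
inst-cong p (var x)   = tm≈ p x
inst-cong p (ƛ M)     = cong ƛ_ (inst-cong (↑λ-cong p) M)
inst-cong p (μ M)     = cong μ_ (inst-cong (↑μ-cong p) M)
inst-cong {e = e} p (⟦ α ⟧ M) rewrite name≈ p α | stk≈ p α = cong (λ U → ⟦ _ ⟧ (U ·* stk e α)) (inst-cong p M)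
inst-cong p (M · N)   = cong₂ _·_ (inst-cong p M) (inst-cong p N)

-- Renamings and the composition law.

ren : (Fin l → Fin l′) → (Fin m → Fin m′) → Subst l m l′ m′
ren ρ π = ⟨ var ∘ ρ , π , (λ _ → []) ⟩

↑λ-ren : (ρ : Fin l → Fin l′) (π : Fin m → Fin m′) → ren (ext ρ) π ≈ ↑λ (ren ρ π)
↑λ-ren ρ π = ⟨ (λ { zero → refl ; (suc x) → refl }) , (λ _ → refl) , (λ _ → refl) ⟩

↑μ-ren : (ρ : Fin l → Fin l′) (π : Fin m → Fin m′) → ren ρ (ext π) ≈ ↑μ (ren ρ π)
↑μ-ren ρ π = ⟨ (λ _ → refl) , (λ _ → refl) , (λ { zero → refl ; (suc α) → refl }) ⟩

rename≡inst : (ρ : Fin l → Fin l′) (π : Fin m → Fin m′) → rename ρ π ≗ inst (ren ρ π)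
rename≡inst ρ π (var x)   = refl
rename≡inst ρ π (ƛ M)     =
  cong ƛ_ (trans (rename≡inst (ext ρ) π M) (inst-cong (↑λ-ren ρ π) M))
rename≡inst ρ π (μ M)     =
  cong μ_ (trans (rename≡inst ρ (ext π) M) (inst-cong (↑μ-ren ρ π) M))
rename≡inst ρ π (⟦ α ⟧ M) = cong ⟦ π α ⟧_ (rename≡inst ρ π M)
rename≡inst ρ π (M · N)   = cong₂ _·_ (rename≡inst ρ π M) (rename≡inst ρ π N)

-- Composition with a renaming, on either side, has to precede the general law: lifting a
-- composition under a binder requires that `inst` commutes with weakening, and weakening is a
-- renaming.
inst-rename : (e : Subst l′ m′ l″ m″) (ρ : Fin l → Fin l′) (π : Fin m → Fin m′) →
              inst e ∘ rename ρ π ≗ inst ⟨ tm e ∘ ρ , name e ∘ π , stk e ∘ π ⟩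
inst-rename e ρ π (var x)   = refl
inst-rename e ρ π (ƛ M)     = cong ƛ_ (trans (inst-rename (↑λ e) (ext ρ) π M)
  (inst-cong ⟨ (λ { zero → refl ; (suc x) → refl }) , (λ _ → refl) , (λ _ → refl) ⟩ M))
inst-rename e ρ π (μ M)     = cong μ_ (trans (inst-rename (↑μ e) ρ (ext π) M)
  (inst-cong ⟨ (λ _ → refl) , (λ { zero → refl ; (suc x) → refl })
             , (λ { zero → refl ; (suc x) → refl }) ⟩ M))
inst-rename e ρ π (⟦ α ⟧ M) = cong (λ U → ⟦ _ ⟧ (U ·* stk e (π α))) (inst-rename e ρ π M)
inst-rename e ρ π (M · N)   = cong₂ _·_ (inst-rename e ρ π M) (inst-rename e ρ π N)

rename-rename : (ρ′ : Fin l′ → Fin l″) (π′ : Fin m′ → Fin m″)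
                (ρ : Fin l → Fin l′) (π : Fin m → Fin m′) →
                rename ρ′ π′ ∘ rename ρ π ≗ rename (ρ′ ∘ ρ) (π′ ∘ π)
rename-rename ρ′ π′ ρ π M = begin
  rename ρ′ π′ (rename ρ π M)       ≡⟨ rename≡inst ρ′ π′ _ ⟩
  inst (ren ρ′ π′) (rename ρ π M)   ≡⟨ inst-rename (ren ρ′ π′) ρ π M ⟩
  inst (ren (ρ′ ∘ ρ) (π′ ∘ π)) M    ≡⟨ rename≡inst (ρ′ ∘ ρ) (π′ ∘ π) M ⟨
  rename (ρ′ ∘ ρ) (π′ ∘ π) M        ∎
  where open ≡-Reasoning

rename-·* : (ρ : Fin l → Fin l′) (π : Fin m → Fin m′) (M : Tm l m) (Ps : List (Tm l m)) →
            rename ρ π (M ·* Ps) ≡ rename ρ π M ·* map (rename ρ π) Ps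
rename-·* ρ π M []       = refl
rename-·* ρ π M (P ∷ Ps) = rename-·* ρ π (M · P) Ps

inst-·* : (e : Subst l m l′ m′) (M : Tm l m) (Ps : List (Tm l m)) →
          inst e (M ·* Ps) ≡ inst e M ·* map (inst e) Ps
inst-·* e M []       = refl
inst-·* e M (P ∷ Ps) = inst-·* e (M · P) Ps

map-comm : ∀ {A B B′ C : Set} {f : B → C} {g : A → B} {f′ : B′ → C} {g′ : A → B′} →
           f ∘ g ≗ f′ ∘ g′ → map f ∘ map g ≗ map f′ ∘ map g′
map-comm p xs = trans (sym (map-∘ xs)) (trans (map-cong p xs) (map-∘ xs))

rename-inst : (ρ : Fin l′ → Fin l″) (π : Fin m′ → Fin m″) (e : Subst l m l′ m′) →
              rename ρ π ∘ inst e ≗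
              inst ⟨ rename ρ π ∘ tm e , π ∘ name e , map (rename ρ π) ∘ stk e ⟩
rename-inst ρ π e (var x)   = refl
rename-inst ρ π e (ƛ M)     = cong ƛ_ (trans (rename-inst (ext ρ) π (↑λ e) M)
  (inst-cong ⟨ (λ { zero → refl ; (suc x) → wkλ-rename (tm e x) }) , (λ _ → refl)
             , (λ α → map-comm wkλ-rename (stk e α)) ⟩ M))
  where
  wkλ-rename : rename (ext ρ) π ∘ wkλ ≗ wkλ ∘ rename ρ π
  wkλ-rename T = trans (rename-rename (ext ρ) π suc id T) (sym (rename-rename suc id ρ π T))
rename-inst ρ π e (μ M)     = cong μ_ (trans (rename-inst ρ (ext π) (↑μ e) M)
  (inst-cong ⟨ (λ x → wkμ-rename (tm e x)) , (λ { zero → refl ; (suc α) → refl })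
             , (λ { zero → refl ; (suc α) → map-comm wkμ-rename (stk e α) }) ⟩ M))
  where
  wkμ-rename : rename ρ (ext π) ∘ wkμ ≗ wkμ ∘ rename ρ π
  wkμ-rename T = trans (rename-rename ρ (ext π) id suc T) (sym (rename-rename id suc ρ π T))
rename-inst ρ π e (⟦ α ⟧ M) = cong ⟦ _ ⟧_ (trans (rename-·* ρ π (inst e M) (stk e α))
  (cong (_·* map (rename ρ π) (stk e α)) (rename-inst ρ π e M)))
rename-inst ρ π e (M · N)   = cong₂ _·_ (rename-inst ρ π e M) (rename-inst ρ π e N)

inst-wkλ : (e : Subst l m l′ m′) → inst (↑λ e) ∘ wkλ ≗ wkλ ∘ inst e
inst-wkλ e T = trans (inst-rename (↑λ e) suc id T) (sym (rename-inst suc id e T))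

inst-wkμ : (e : Subst l m l′ m′) → inst (↑μ e) ∘ wkμ ≗ wkμ ∘ inst e
inst-wkμ e T = trans (inst-rename (↑μ e) id suc T) (sym (rename-inst id suc e T))

infixr 9 _⊙_
-- In the composite stack the arguments supplied by `d` stand next to the named subterm, so they
-- come first, instantiated by `e`; those that `e` attaches to the new name follow.
_⊙_ : Subst l′ m′ l″ m″ → Subst l m l′ m′ → Subst l m l″ m″
e ⊙ d = ⟨ inst e ∘ tm d , name e ∘ name d , (λ α → map (inst e) (stk d α) ++ stk e (name d α)) ⟩

map-inst-wk : ∀ {A B C D : Set} {f : B → D} {w : A → B} {w′ : C → D} {f′ : A → C} →
              f ∘ w ≗ w′ ∘ f′ → ∀ Ps Qs → map f (map w Ps) ++ map w′ Qs ≡ map w′ (map f′ Ps ++ Qs)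
map-inst-wk {w′ = w′} p Ps Qs =
  trans (cong (_++ map w′ Qs) (map-comm p Ps)) (sym (map-++ w′ _ Qs))

inst-inst : (e : Subst l′ m′ l″ m″) (d : Subst l m l′ m′) → inst e ∘ inst d ≗ inst (e ⊙ d)
inst-inst e d (var x)   = refl
inst-inst e d (ƛ M)     = cong ƛ_ (trans (inst-inst (↑λ e) (↑λ d) M)
  (inst-cong ⟨ (λ { zero → refl ; (suc x) → inst-wkλ e (tm d x) }) , (λ _ → refl)
             , (λ α → map-inst-wk (inst-wkλ e) (stk d α) _) ⟩ M))
inst-inst e d (μ M)     = cong μ_ (trans (inst-inst (↑μ e) (↑μ d) M)
  (inst-cong ⟨ (λ x → inst-wkμ e (tm d x)) , (λ { zero → refl ; (suc α) → refl })
             , (λ { zero → refl ; (suc α) → map-inst-wk (inst-wkμ e) (stk d α) _ }) ⟩ M))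
inst-inst e d (⟦ α ⟧ M) = cong ⟦ _ ⟧_ (begin
  inst e (inst d M ·* stk d α) ·* stk e (name d α)
    ≡⟨ cong (_·* stk e (name d α)) (inst-·* e (inst d M) (stk d α)) ⟩
  inst e (inst d M) ·* map (inst e) (stk d α) ·* stk e (name d α)
    ≡⟨ foldl-++ _·_ _ (map (inst e) (stk d α)) _ ⟨
  inst e (inst d M) ·* stk (e ⊙ d) α
    ≡⟨ cong (_·* stk (e ⊙ d) α) (inst-inst e d M) ⟩
  inst (e ⊙ d) M ·* stk (e ⊙ d) α ∎)
  where open ≡-Reasoning
inst-inst e d (M · N)   = cong₂ _·_ (inst-inst e d M) (inst-inst e d N)

inst-id : {e : Subst l m l m} → e ≈ ren id id → inst e ≗ id
inst-id p (var x)   = tm≈ p x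
inst-id p (ƛ M)     = cong ƛ_ (inst-id (≈-trans (↑λ-cong p)
  ⟨ (λ { zero → refl ; (suc x) → refl }) , (λ _ → refl) , (λ _ → refl) ⟩) M)
inst-id p (μ M)     = cong μ_ (inst-id (≈-trans (↑μ-cong p)
  ⟨ (λ _ → refl) , (λ { zero → refl ; (suc x) → refl })
  , (λ { zero → refl ; (suc x) → refl }) ⟩) M)
inst-id p (⟦ α ⟧ M) rewrite name≈ p α | stk≈ p α = cong ⟦ α ⟧_ (inst-id p M)
inst-id p (M · N)   = cong₂ _·_ (inst-id p M) (inst-id p N)

-- Contraction as parallel substitution.

βS : Tm l m → Subst (suc l) m l m
βS {l} {m} N = ⟨ t , id , (λ _ → []) ⟩
  where
  t : Fin (suc l) → Tm l m
  t zero    = N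
  t (suc x) = var x

ρS : Fin m → Subst l (suc m) l m
ρS {m} α = ⟨ var , t , (λ _ → []) ⟩
  where
  t : Fin (suc m) → Fin m
  t zero    = α
  t (suc β) = β

-- The effect of consecutive μ-contractions with the arguments `Ps`, performed at once; a single
-- contraction is the case of a one-element list.
push : List (Tm l (suc m)) → Subst l (suc m) l (suc m)
push {l} {m} Ps = ⟨ var , id , t ⟩
  where
  t : Fin (suc m) → List (Tm l (suc m))
  t zero    = Ps
  t (suc β) = []

sub≡inst : (s : Fin l → Tm l′ m) → sub s ≗ inst ⟨ s , id , (λ _ → []) ⟩
sub≡inst s (var x)   = refl
sub≡inst s (ƛ M)     = cong ƛ_ (sub≡inst (extS s) M)
sub≡inst s (μ M)     = cong μ_ (trans (sub≡inst (wkμ ∘ s) M)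
  (inst-cong ⟨ (λ _ → refl) , (λ { zero → refl ; (suc x) → refl })
             , (λ { zero → refl ; (suc x) → refl }) ⟩ M))
sub≡inst s (⟦ α ⟧ M) = cong ⟦ α ⟧_ (sub≡inst s M)
sub≡inst s (M · N)   = cong₂ _·_ (sub≡inst s M) (sub≡inst s N)

[]≡inst : (M : Tm (suc l) m) (N : Tm l m) → M [ N ] ≡ inst (βS N) M
[]≡inst M N = trans (sub≡inst _ M)
  (inst-cong ⟨ (λ { zero → refl ; (suc x) → refl }) , (λ _ → refl) , (λ _ → refl) ⟩ M)

[≔]≡inst : (M : Tm l (suc m)) (α : Fin m) → M [≔ α ] ≡ inst (ρS α) M
[≔]≡inst M α = trans (rename≡inst id _ M)
  (inst-cong ⟨ (λ _ → refl) , (λ { zero → refl ; (suc x) → refl }) , (λ _ → refl) ⟩ M)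

-- The substitution is characterised by its values instead of being fixed: under a μ-binder the
-- index α moves to `suc α`, and the four conditions are stable under both liftings.
≔ᵣ≡inst : (M : Tm l m) {α : Fin m} {N : Tm l m} {e : Subst l m l m} →
          tm e ≗ var → name e ≗ id → stk e α ≡ N ∷ [] → (∀ β → β ≢ α → stk e β ≡ []) →
          M [ α ≔ᵣ N ] ≡ inst e M
≔ᵣ≡inst (var x)   p q r r′ = sym (p x)
≔ᵣ≡inst (ƛ M)     p q r r′ = cong ƛ_
  (≔ᵣ≡inst M (λ { zero → refl ; (suc x) → cong wkλ (p x) }) q (cong (map wkλ) r)
           (λ β → cong (map wkλ) ∘ r′ β))
≔ᵣ≡inst (μ M)     p q r r′ = cong μ_
  (≔ᵣ≡inst M (λ x → cong wkμ (p x)) (λ { zero → refl ; (suc x) → cong suc (q x) })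
           (cong (map wkμ) r)
           (λ { zero _ → refl ; (suc β) β≢α → cong (map wkμ) (r′ β (β≢α ∘ cong suc)) }))
≔ᵣ≡inst (⟦ β ⟧ M) {α} p q r r′ with β ≟ α
... | yes refl rewrite q β | r = cong (λ U → ⟦ β ⟧ (U · _)) (≔ᵣ≡inst M p q r r′)
... | no β≢α rewrite q β | r′ β β≢α = cong ⟦ β ⟧_ (≔ᵣ≡inst M p q r r′)
≔ᵣ≡inst (M · N)   p q r r′ = cong₂ _·_ (≔ᵣ≡inst M p q r r′) (≔ᵣ≡inst N p q r r′)

≔ᵣ≡push : (M : Tm l (suc m)) (N : Tm l (suc m)) → M [ zero ≔ᵣ N ] ≡ inst (push (N ∷ [])) M
≔ᵣ≡push M N = ≔ᵣ≡inst M (λ _ → refl) (λ _ → refl) refl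
  (λ { zero 0≢0 → contradiction refl 0≢0 ; (suc β) _ → refl })

inst-β-wk : (N : Tm l m) → inst (βS N) ∘ wkλ ≗ id
inst-β-wk N T = trans (inst-rename (βS N) suc id T)
  (inst-id ⟨ (λ _ → refl) , (λ _ → refl) , (λ _ → refl) ⟩ T)

inst-ρ-wk : (α : Fin m) → inst {l} (ρS α) ∘ wkμ ≗ id
inst-ρ-wk α T = trans (inst-rename (ρS α) id suc T)
  (inst-id ⟨ (λ _ → refl) , (λ _ → refl) , (λ _ → refl) ⟩ T)

inst-push-wk : (Ps : List (Tm l (suc m))) → inst (push Ps) ∘ wkμ ≗ wkμ
inst-push-wk Ps T = trans (inst-rename (push Ps) id suc T) (sym (rename≡inst id suc T))

map-cancel : ∀ {A B : Set} {f : B → A} {g : A → B} → f ∘ g ≗ id → map f ∘ map g ≗ id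
map-cancel p xs = trans (sym (map-∘ xs)) (trans (map-cong p xs) (map-id xs))

inst-[] : (e : Subst l m l′ m′) (M : Tm (suc l) m) (N : Tm l m) →
          inst e (M [ N ]) ≡ inst (↑λ e) M [ inst e N ]
inst-[] e M N = begin
  inst e (M [ N ])                      ≡⟨ cong (inst e) ([]≡inst M N) ⟩
  inst e (inst (βS N) M)                ≡⟨ inst-inst e (βS N) M ⟩
  inst (e ⊙ βS N) M                     ≡⟨ inst-cong eq M ⟩
  inst (βS (inst e N) ⊙ ↑λ e) M         ≡⟨ inst-inst (βS (inst e N)) (↑λ e) M ⟨
  inst (βS (inst e N)) (inst (↑λ e) M)  ≡⟨ []≡inst (inst (↑λ e) M) (inst e N) ⟨
  inst (↑λ e) M [ inst e N ]            ∎
  where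
  open ≡-Reasoning
  eq : e ⊙ βS N ≈ βS (inst e N) ⊙ ↑λ e
  eq = ⟨ (λ { zero → refl ; (suc x) → sym (inst-β-wk (inst e N) (tm e x)) }) , (λ _ → refl)
       , (λ α → sym (trans (++-identityʳ _) (map-cancel (inst-β-wk _) (stk e α)))) ⟩

inst-≔ᵣ : (e : Subst l m l′ m′) (M : Tm l (suc m)) (N : Tm l m) →
          inst (↑μ e) (M [ zero ≔ᵣ wkμ N ]) ≡ inst (↑μ e) M [ zero ≔ᵣ wkμ (inst e N) ]
inst-≔ᵣ e M N = begin
  inst (↑μ e) (M [ zero ≔ᵣ wkμ N ])                     ≡⟨ cong (inst (↑μ e)) (≔ᵣ≡push M (wkμ N)) ⟩
  inst (↑μ e) (inst (push (wkμ N ∷ [])) M)                 ≡⟨ inst-inst (↑μ e) _ M ⟩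
  inst (↑μ e ⊙ push (wkμ N ∷ [])) M                        ≡⟨ inst-cong eq M ⟩
  inst (push (wkμ (inst e N) ∷ []) ⊙ ↑μ e) M               ≡⟨ inst-inst _ (↑μ e) M ⟨
  inst (push (wkμ (inst e N) ∷ [])) (inst (↑μ e) M)        ≡⟨ ≔ᵣ≡push (inst (↑μ e) M) _ ⟨
  inst (↑μ e) M [ zero ≔ᵣ wkμ (inst e N) ]              ∎
  where
  open ≡-Reasoning
  eq : ↑μ e ⊙ push (wkμ N ∷ []) ≈ push (wkμ (inst e N) ∷ []) ⊙ ↑μ e
  eq = ⟨ (λ x → sym (inst-push-wk _ (tm e x))) , (λ _ → refl)
       , (λ { zero → cong (_∷ []) (inst-wkμ e N)
            ; (suc α) → sym (trans (++-identityʳ _)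
                (trans (sym (map-∘ (stk e α))) (map-cong (inst-push-wk _) (stk e α)))) }) ⟩

-- On the right, the binder first absorbs the stack that `e` attaches to α, as it must in
-- `[α]((μβ.M) P₁ ⋯ Pₙ)` before the ρ-contraction becomes possible.
inst-[≔] : (e : Subst l m l′ m′) (M : Tm l (suc m)) (α : Fin m) →
           inst e (M [≔ α ]) ≡
           inst (push (map wkμ (stk e α))) (inst (↑μ e) M) [≔ name e α ]
inst-[≔] e M α = begin
  inst e (M [≔ α ])                                     ≡⟨ cong (inst e) ([≔]≡inst M α) ⟩
  inst e (inst (ρS α) M)                                ≡⟨ inst-inst e (ρS α) M ⟩
  inst (e ⊙ ρS α) M                                     ≡⟨ inst-cong eq M ⟩
  inst (ρS (name e α) ⊙ push Ps ⊙ ↑μ e) M               ≡⟨ inst-inst _ (push Ps ⊙ ↑μ e) M ⟨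
  inst (ρS (name e α)) (inst (push Ps ⊙ ↑μ e) M)        ≡⟨ cong (inst _) (inst-inst (push Ps) (↑μ e) M) ⟨
  inst (ρS (name e α)) (inst (push Ps) (inst (↑μ e) M)) ≡⟨ [≔]≡inst _ _ ⟨
  inst (push Ps) (inst (↑μ e) M) [≔ name e α ]          ∎
  where
  open ≡-Reasoning
  Ps = map wkμ (stk e α)
  eq : e ⊙ ρS α ≈ ρS (name e α) ⊙ push Ps ⊙ ↑μ e
  eq = ⟨ (λ x → sym (trans (cong (inst _) (inst-push-wk Ps (tm e x))) (inst-ρ-wk _ (tm e x))))
       , (λ { zero → refl ; (suc β) → refl })
       , (λ { zero → sym (trans (++-identityʳ _) (map-cancel (inst-ρ-wk _) (stk e α)))
            ; (suc β) → sym (trans (++-identityʳ _) (trans (cong (map _)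
                (trans (++-identityʳ _)
                  (trans (sym (map-∘ (stk e β))) (map-cong (inst-push-wk Ps) (stk e β)))))
                (map-cancel (inst-ρ-wk _) (stk e β)))) }) ⟩

-- Injectivity of renaming.

ext-injective : {ρ : Fin k → Fin n} → (∀ {x y} → ρ x ≡ ρ y → x ≡ y) →
                ∀ {x y} → ext ρ x ≡ ext ρ y → x ≡ y
ext-injective ρ-inj {zero}  {zero}  _  = refl
ext-injective ρ-inj {suc x} {suc y} eq = cong suc (ρ-inj (suc-injective eq))

var-injective : {x y : Fin l} → var {l} {m} x ≡ var y → x ≡ y
var-injective refl = refl

ƛ-injective : {M N : Tm (suc l) m} → ƛ M ≡ ƛ N → M ≡ N
ƛ-injective refl = refl

μ-injective : {M N : Tm l (suc m)} → μ M ≡ μ N → M ≡ N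
μ-injective refl = refl

⟦⟧-injective : {α β : Fin m} {M N : Tm l m} → ⟦ α ⟧ M ≡ ⟦ β ⟧ N → α ≡ β × M ≡ N
⟦⟧-injective refl = refl , refl

·-injective : {M M′ N N′ : Tm l m} → M · N ≡ M′ · N′ → M ≡ M′ × N ≡ N′
·-injective refl = refl , refl

rename-injective : {ρ : Fin l → Fin l′} {π : Fin m → Fin m′} →
                   (∀ {x y} → ρ x ≡ ρ y → x ≡ y) → (∀ {x y} → π x ≡ π y → x ≡ y) →
                   ∀ M N → rename ρ π M ≡ rename ρ π N → M ≡ N
rename-injective ρi πi (var x) (var y) eq = cong var (ρi (var-injective eq))
rename-injective ρi πi (ƛ M) (ƛ N) eq =
  cong ƛ_ (rename-injective (ext-injective ρi) πi M N (ƛ-injective eq))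
rename-injective ρi πi (μ M) (μ N) eq =
  cong μ_ (rename-injective ρi (ext-injective πi) M N (μ-injective eq))
rename-injective ρi πi (⟦ α ⟧ M) (⟦ β ⟧ N) eq =
  let p , q = ⟦⟧-injective eq in cong₂ ⟦_⟧_ (πi p) (rename-injective ρi πi M N q)
rename-injective ρi πi (M · M′) (N · N′) eq =
  let p , q = ·-injective eq
  in cong₂ _·_ (rename-injective ρi πi M N p) (rename-injective ρi πi M′ N′ q)

wkμ-injective : {M N : Tm l m} → wkμ M ≡ wkμ N → M ≡ N
wkμ-injective = rename-injective id suc-injective _ _

-- Free variables

infix 4 _∈Fv_
_∈Fv_ : Fin l ⊎ Fin m → Tm l m → Set
inj₁ x ∈Fv M = x ∈Fvλ M
inj₂ α ∈Fv M = α ∈Fvμ M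

∈-ƛ : ∀ v {M : Tm (suc l) m} → Sum.map suc id v ∈Fv M → v ∈Fv (ƛ M)
∈-ƛ (inj₁ x) = fv-ƛ
∈-ƛ (inj₂ α) = fv-ƛ

∈-μ : ∀ v {M : Tm l (suc m)} → Sum.map id suc v ∈Fv M → v ∈Fv (μ M)
∈-μ (inj₁ x) = fv-μ
∈-μ (inj₂ α) = fv-μ

∈-⟦⟧ : ∀ v {β} {M : Tm l m} → v ∈Fv M → v ∈Fv (⟦ β ⟧ M)
∈-⟦⟧ (inj₁ x) = fv-⟦⟧
∈-⟦⟧ (inj₂ α) = fv-⟦⟧

∈-·ˡ : ∀ v {M N : Tm l m} → v ∈Fv M → v ∈Fv (M · N)
∈-·ˡ (inj₁ x) = fv-appˡ
∈-·ˡ (inj₂ α) = fv-appˡ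

∈-·ʳ : ∀ v {M N : Tm l m} → v ∈Fv N → v ∈Fv (M · N)
∈-·ʳ (inj₁ x) = fv-appʳ
∈-·ʳ (inj₂ α) = fv-appʳ

∈-·*ˡ : ∀ v {M : Tm l m} Ps → v ∈Fv M → v ∈Fv (M ·* Ps)
∈-·*ˡ v []       p = p
∈-·*ˡ v (P ∷ Ps) p = ∈-·*ˡ v Ps (∈-·ˡ v p)

∈-·*ʳ : ∀ v {M : Tm l m} {Ps} → Any (v ∈Fv_) Ps → v ∈Fv (M ·* Ps)
∈-·*ʳ v {Ps = P ∷ Ps} (here p) = ∈-·*ˡ v Ps (∈-·ʳ v p)
∈-·*ʳ v (there p)              = ∈-·*ʳ v p

fvλ-rename : (ρ : Fin l → Fin l′) (π : Fin m → Fin m′) {M : Tm l m} {x : Fin l} →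
             x ∈Fvλ M → ρ x ∈Fvλ rename ρ π M
fvλ-rename ρ π fv-var      = fv-var
fvλ-rename ρ π (fv-ƛ p)    = fv-ƛ (fvλ-rename (ext ρ) π p)
fvλ-rename ρ π (fv-μ p)    = fv-μ (fvλ-rename ρ (ext π) p)
fvλ-rename ρ π (fv-⟦⟧ p)   = fv-⟦⟧ (fvλ-rename ρ π p)
fvλ-rename ρ π (fv-appˡ p) = fv-appˡ (fvλ-rename ρ π p)
fvλ-rename ρ π (fv-appʳ p) = fv-appʳ (fvλ-rename ρ π p)

fvμ-rename : (ρ : Fin l → Fin l′) (π : Fin m → Fin m′) {M : Tm l m} {α : Fin m} →
             α ∈Fvμ M → π α ∈Fvμ rename ρ π M
fvμ-rename ρ π fv-name     = fv-name
fvμ-rename ρ π (fv-⟦⟧ p)   = fv-⟦⟧ (fvμ-rename ρ π p)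
fvμ-rename ρ π (fv-ƛ p)    = fv-ƛ (fvμ-rename (ext ρ) π p)
fvμ-rename ρ π (fv-μ p)    = fv-μ (fvμ-rename ρ (ext π) p)
fvμ-rename ρ π (fv-appˡ p) = fv-appˡ (fvμ-rename ρ π p)
fvμ-rename ρ π (fv-appʳ p) = fv-appʳ (fvμ-rename ρ π p)

∈-rename : (ρ : Fin l → Fin l′) (π : Fin m → Fin m′) {M : Tm l m} →
           ∀ v → v ∈Fv M → Sum.map ρ π v ∈Fv rename ρ π M
∈-rename ρ π (inj₁ x) = fvλ-rename ρ π
∈-rename ρ π (inj₂ α) = fvμ-rename ρ π

ext-suc⁻ : {ρ : Fin k → Fin n} {P : Fin (suc k) → Set} {y : Fin n} →
           (∃ λ x → P x × ext ρ x ≡ suc y) → ∃ λ x → P (suc x) × ρ x ≡ y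
ext-suc⁻ (suc x , p , eq) = x , p , suc-injective eq

fvλ-rename⁻ : (ρ : Fin l → Fin l′) (π : Fin m → Fin m′) (M : Tm l m) {y : Fin l′} →
              y ∈Fvλ rename ρ π M → ∃ λ x → x ∈Fvλ M × ρ x ≡ y
fvλ-rename⁻ ρ π (var x)   fv-var      = x , fv-var , refl
fvλ-rename⁻ ρ π (ƛ M)     (fv-ƛ p)    =
  let x , q , eq = ext-suc⁻ (fvλ-rename⁻ (ext ρ) π M p) in x , fv-ƛ q , eq
fvλ-rename⁻ ρ π (μ M)     (fv-μ p)    =
  let x , q , eq = fvλ-rename⁻ ρ (ext π) M p in x , fv-μ q , eq
fvλ-rename⁻ ρ π (⟦ α ⟧ M) (fv-⟦⟧ p)   =
  let x , q , eq = fvλ-rename⁻ ρ π M p in x , fv-⟦⟧ q , eq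
fvλ-rename⁻ ρ π (M · N)   (fv-appˡ p) =
  let x , q , eq = fvλ-rename⁻ ρ π M p in x , fv-appˡ q , eq
fvλ-rename⁻ ρ π (M · N)   (fv-appʳ p) =
  let x , q , eq = fvλ-rename⁻ ρ π N p in x , fv-appʳ q , eq

fvμ-rename⁻ : (ρ : Fin l → Fin l′) (π : Fin m → Fin m′) (M : Tm l m) {β : Fin m′} →
              β ∈Fvμ rename ρ π M → ∃ λ α → α ∈Fvμ M × π α ≡ β
fvμ-rename⁻ ρ π (ƛ M)     (fv-ƛ p)    =
  let α , q , eq = fvμ-rename⁻ (ext ρ) π M p in α , fv-ƛ q , eq
fvμ-rename⁻ ρ π (μ M)     (fv-μ p)    =
  let α , q , eq = ext-suc⁻ (fvμ-rename⁻ ρ (ext π) M p) in α , fv-μ q , eq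
fvμ-rename⁻ ρ π (⟦ α ⟧ M) fv-name     = α , fv-name , refl
fvμ-rename⁻ ρ π (⟦ _ ⟧ M) (fv-⟦⟧ p)   =
  let α , q , eq = fvμ-rename⁻ ρ π M p in α , fv-⟦⟧ q , eq
fvμ-rename⁻ ρ π (M · N)   (fv-appˡ p) =
  let α , q , eq = fvμ-rename⁻ ρ π M p in α , fv-appˡ q , eq
fvμ-rename⁻ ρ π (M · N)   (fv-appʳ p) =
  let α , q , eq = fvμ-rename⁻ ρ π N p in α , fv-appʳ q , eq

zero∉wkμ : {M : Tm l m} → ¬ zero ∈Fvμ wkμ M
zero∉wkμ {M = M} p with fvμ-rename⁻ id suc M p
... | _ , _ , ()

-- Strengthening, proved for arbitrary renamings because weakening does not stay weakening under a
-- binder: `suc` turns into `ext suc`, and `ext id` equals `id` only pointwise.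
rename-range : (ρ : Fin l → Fin l) (π : Fin m → Fin m′) (M : Tm l m′) → ρ ≗ id →
               (∀ {α} → α ∈Fvμ M → ∃ λ β → π β ≡ α) → ∃ λ M₀ → M ≡ rename ρ π M₀
rename-range ρ π (var x)   ρ≗id h = var x , cong var (sym (ρ≗id x))
rename-range ρ π (ƛ M)     ρ≗id h =
  let M₀ , eq = rename-range (ext ρ) π M (λ { zero → refl ; (suc x) → cong suc (ρ≗id x) })
                             (h ∘ fv-ƛ)
  in ƛ M₀ , cong ƛ_ eq
rename-range ρ π (μ M)     ρ≗id h =
  let M₀ , eq = rename-range ρ (ext π) M ρ≗id
                  (λ { {zero} _ → zero , refl
                     ; {suc α} p → let β , eq = h (fv-μ p) in suc β , cong suc eq })
  in μ M₀ , cong μ_ eq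
rename-range ρ π (⟦ α ⟧ M) ρ≗id h =
  let β , eq₁ = h fv-name
      M₀ , eq₂ = rename-range ρ π M ρ≗id (h ∘ fv-⟦⟧)
  in ⟦ β ⟧ M₀ , cong₂ ⟦_⟧_ (sym eq₁) eq₂
rename-range ρ π (M · N)   ρ≗id h =
  let M₀ , eq₁ = rename-range ρ π M ρ≗id (h ∘ fv-appˡ)
      N₀ , eq₂ = rename-range ρ π N ρ≗id (h ∘ fv-appʳ)
  in M₀ · N₀ , cong₂ _·_ eq₁ eq₂

zero∉⇒wkμ : (M : Tm l (suc m)) → ¬ zero ∈Fvμ M → ∃ λ M₀ → M ≡ wkμ M₀
zero∉⇒wkμ M 0∉M = rename-range id suc M (λ _ → refl)
  λ { {zero} p → contradiction p 0∉M ; {suc α} _ → α , refl }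

-- The free variables that  inst e  puts in place of an occurrence of v.
Image : Subst l m l′ m′ → Fin l ⊎ Fin m → Fin l′ ⊎ Fin m′ → Set
Image e (inj₁ x) w = w ∈Fv tm e x
Image e (inj₂ α) w = w ≡ inj₂ (name e α) ⊎ Any (w ∈Fv_) (stk e α)

Image-↑λ : (e : Subst l m l′ m′) → ∀ v w → Image e v w →
           Image (↑λ e) (Sum.map suc id v) (Sum.map suc id w)
Image-↑λ e (inj₁ x) w p           = ∈-rename suc id w p
Image-↑λ e (inj₂ α) w (inj₁ refl) = inj₁ refl
Image-↑λ e (inj₂ α) w (inj₂ p)    = inj₂ (Any.map⁺ (Any.map (∈-rename suc id w) p))

Image-↑μ : (e : Subst l m l′ m′) → ∀ v w → Image e v w →
           Image (↑μ e) (Sum.map id suc v) (Sum.map id suc w)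
Image-↑μ e (inj₁ x) w p           = ∈-rename id suc w p
Image-↑μ e (inj₂ α) w (inj₁ refl) = inj₁ refl
Image-↑μ e (inj₂ α) w (inj₂ p)    = inj₂ (Any.map⁺ (Any.map (∈-rename id suc w) p))

∈-inst : (e : Subst l m l′ m′) {M : Tm l m} → ∀ v w → v ∈Fv M → Image e v w → w ∈Fv inst e M
∈-inst e (inj₁ x) w fv-var i = i
∈-inst e (inj₁ x) w (fv-ƛ p) i =
  ∈-ƛ w (∈-inst (↑λ e) (inj₁ (suc x)) _ p (Image-↑λ e (inj₁ x) w i))
∈-inst e (inj₁ x) w (fv-μ p) i =
  ∈-μ w (∈-inst (↑μ e) (inj₁ x) _ p (Image-↑μ e (inj₁ x) w i))
∈-inst e (inj₁ x) w (fv-⟦⟧ {β} p) i = ∈-⟦⟧ w (∈-·*ˡ w (stk e β) (∈-inst e (inj₁ x) w p i))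
∈-inst e (inj₁ x) w (fv-appˡ p) i = ∈-·ˡ w (∈-inst e (inj₁ x) w p i)
∈-inst e (inj₁ x) w (fv-appʳ p) i = ∈-·ʳ w (∈-inst e (inj₁ x) w p i)
∈-inst e (inj₂ α) w fv-name (inj₁ refl) = fv-name
∈-inst e (inj₂ α) w fv-name (inj₂ i) = ∈-⟦⟧ w (∈-·*ʳ w i)
∈-inst e (inj₂ α) w (fv-ƛ p) i =
  ∈-ƛ w (∈-inst (↑λ e) (inj₂ α) _ p (Image-↑λ e (inj₂ α) w i))
∈-inst e (inj₂ α) w (fv-μ p) i =
  ∈-μ w (∈-inst (↑μ e) (inj₂ (suc α)) _ p (Image-↑μ e (inj₂ α) w i))
∈-inst e (inj₂ α) w (fv-⟦⟧ {β} p) i = ∈-⟦⟧ w (∈-·*ˡ w (stk e β) (∈-inst e (inj₂ α) w p i))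
∈-inst e (inj₂ α) w (fv-appˡ p) i = ∈-·ˡ w (∈-inst e (inj₂ α) w p i)
∈-inst e (inj₂ α) w (fv-appʳ p) i = ∈-·ʳ w (∈-inst e (inj₂ α) w p i)

-- At a β- or μ-contraction the argument is placed at an occurrence of the bound variable, which
-- exists in a λμI-term; its free variables reappear there. In the ρ case the same occurrence keeps
-- the outer name α.
fv-step : {M M′ : Tm l m} → λμI M → M ⟶ M′ → ∀ v → v ∈Fv M → v ∈Fv M′
fv-step (I-app (I-ƛ iM 0∈M) iN) (β-red M N) v v∈ = subst (v ∈Fv_) (sym ([]≡inst M N)) (go v v∈)
  where
  go : ∀ v → v ∈Fv ((ƛ M) · N) → v ∈Fv inst (βS N) M
  go (inj₁ x) (fv-appˡ (fv-ƛ p)) = ∈-inst (βS N) (inj₁ (suc x)) (inj₁ x) p fv-var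
  go (inj₁ x) (fv-appʳ q)        = ∈-inst (βS N) (inj₁ zero) (inj₁ x) 0∈M q
  go (inj₂ α) (fv-appˡ (fv-ƛ p)) = ∈-inst (βS N) (inj₂ α) (inj₂ α) p (inj₁ refl)
  go (inj₂ α) (fv-appʳ q)        = ∈-inst (βS N) (inj₁ zero) (inj₂ α) 0∈M q
fv-step (I-app (I-μ iM 0∈M) iN) (μ-red M N) v v∈ =
  ∈-μ v (subst (Sum.map id suc v ∈Fv_) (sym (≔ᵣ≡push M (wkμ N))) (go v v∈))
  where
  e = push (wkμ N ∷ [])
  go : ∀ v → v ∈Fv ((μ M) · N) → Sum.map id suc v ∈Fv inst e M
  go (inj₁ x) (fv-appˡ (fv-μ p)) = ∈-inst e (inj₁ x) (inj₁ x) p fv-var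
  go (inj₁ x) (fv-appʳ q)        =
    ∈-inst e (inj₂ zero) (inj₁ x) 0∈M (inj₂ (here (fvλ-rename id suc q)))
  go (inj₂ α) (fv-appˡ (fv-μ p)) = ∈-inst e (inj₂ (suc α)) (inj₂ (suc α)) p (inj₁ refl)
  go (inj₂ α) (fv-appʳ q)        =
    ∈-inst e (inj₂ zero) (inj₂ (suc α)) 0∈M (inj₂ (here (fvμ-rename id suc q)))
fv-step (I-⟦⟧ (I-μ iM 0∈M)) (ρ-red α M) v v∈ = subst (v ∈Fv_) (sym ([≔]≡inst M α)) (go v v∈)
  where
  go : ∀ v → v ∈Fv (⟦ α ⟧ μ M) → v ∈Fv inst (ρS α) M
  go (inj₁ x) (fv-⟦⟧ (fv-μ p)) = ∈-inst (ρS α) (inj₁ x) (inj₁ x) p fv-var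
  go (inj₂ α) fv-name          = ∈-inst (ρS α) (inj₂ zero) (inj₂ α) 0∈M (inj₁ refl)
  go (inj₂ β) (fv-⟦⟧ (fv-μ p)) = ∈-inst (ρS α) (inj₂ (suc β)) (inj₂ β) p (inj₁ refl)
fv-step i (θ-red M) (inj₁ x) (fv-μ (fv-⟦⟧ p)) with fvλ-rename⁻ id suc M p
... | _ , q , refl = q
fv-step i (θ-red M) (inj₂ α) (fv-μ (fv-⟦⟧ p)) with fvμ-rename⁻ id suc M p
... | _ , q , refl = q
fv-step (I-ƛ i _) (ξƛ s) (inj₁ x) (fv-ƛ p) = fv-ƛ (fv-step i s (inj₁ (suc x)) p)
fv-step (I-ƛ i _) (ξƛ s) (inj₂ α) (fv-ƛ p) = fv-ƛ (fv-step i s (inj₂ α) p)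
fv-step (I-μ i _) (ξμ s) (inj₁ x) (fv-μ p) = fv-μ (fv-step i s (inj₁ x) p)
fv-step (I-μ i _) (ξμ s) (inj₂ α) (fv-μ p) = fv-μ (fv-step i s (inj₂ (suc α)) p)
fv-step (I-⟦⟧ i) (ξ⟦⟧ s) (inj₁ x) (fv-⟦⟧ p) = fv-⟦⟧ (fv-step i s (inj₁ x) p)
fv-step (I-⟦⟧ i) (ξ⟦⟧ s) (inj₂ α) fv-name = fv-name
fv-step (I-⟦⟧ i) (ξ⟦⟧ s) (inj₂ α) (fv-⟦⟧ p) = fv-⟦⟧ (fv-step i s (inj₂ α) p)
fv-step (I-app i j) (ξˡ s) (inj₁ x) (fv-appˡ p) = fv-appˡ (fv-step i s (inj₁ x) p)
fv-step (I-app i j) (ξˡ s) (inj₁ x) (fv-appʳ p) = fv-appʳ p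
fv-step (I-app i j) (ξˡ s) (inj₂ α) (fv-appˡ p) = fv-appˡ (fv-step i s (inj₂ α) p)
fv-step (I-app i j) (ξˡ s) (inj₂ α) (fv-appʳ p) = fv-appʳ p
fv-step (I-app i j) (ξʳ s) (inj₁ x) (fv-appˡ p) = fv-appˡ p
fv-step (I-app i j) (ξʳ s) (inj₁ x) (fv-appʳ p) = fv-appʳ (fv-step j s (inj₁ x) p)
fv-step (I-app i j) (ξʳ s) (inj₂ α) (fv-appˡ p) = fv-appˡ p
fv-step (I-app i j) (ξʳ s) (inj₂ α) (fv-appʳ p) = fv-appʳ (fv-step j s (inj₂ α) p)

-- Preservation of λμI

I-rename : (ρ : Fin l → Fin l′) (π : Fin m → Fin m′) {M : Tm l m} → λμI M → λμI (rename ρ π M)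
I-rename ρ π (I-var x)   = I-var (ρ x)
I-rename ρ π (I-ƛ i p)   = I-ƛ (I-rename (ext ρ) π i) (fvλ-rename (ext ρ) π p)
I-rename ρ π (I-μ i p)   = I-μ (I-rename ρ (ext π) i) (fvμ-rename ρ (ext π) p)
I-rename ρ π (I-⟦⟧ i)    = I-⟦⟧ (I-rename ρ π i)
I-rename ρ π (I-app i j) = I-app (I-rename ρ π i) (I-rename ρ π j)

ext-zero⁻ : {ρ : Fin k → Fin n} {P : Fin (suc k) → Set} →
            (∃ λ x → P x × ext ρ x ≡ zero) → P zero
ext-zero⁻ (zero , p , _) = p

I-rename⁻ : (ρ : Fin l → Fin l′) (π : Fin m → Fin m′) (M : Tm l m) → λμI (rename ρ π M) → λμI M
I-rename⁻ ρ π (var x)   i           = I-var x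
I-rename⁻ ρ π (ƛ M)     (I-ƛ i p)   =
  I-ƛ (I-rename⁻ (ext ρ) π M i) (ext-zero⁻ (fvλ-rename⁻ (ext ρ) π M p))
I-rename⁻ ρ π (μ M)     (I-μ i p)   =
  I-μ (I-rename⁻ ρ (ext π) M i) (ext-zero⁻ (fvμ-rename⁻ ρ (ext π) M p))
I-rename⁻ ρ π (⟦ α ⟧ M) (I-⟦⟧ i)    = I-⟦⟧ (I-rename⁻ ρ π M i)
I-rename⁻ ρ π (M · N)   (I-app i j) = I-app (I-rename⁻ ρ π M i) (I-rename⁻ ρ π N j)

I-·* : {M : Tm l m} {Ps : List (Tm l m)} → λμI M → All λμI Ps → λμI (M ·* Ps)
I-·* i []       = i
I-·* i (j ∷ js) = I-·* (I-app i j) js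

I-inst : (e : Subst l m l′ m′) {M : Tm l m} →
         (∀ x → λμI (tm e x)) → (∀ α → All λμI (stk e α)) → λμI M → λμI (inst e M)
I-inst e t s (I-var x)   = t x
I-inst e t s (I-ƛ i p)   = I-ƛ
  (I-inst (↑λ e) (λ { zero → I-var zero ; (suc x) → I-rename suc id (t x) })
          (λ α → All.map⁺ (All.map (I-rename suc id) (s α))) i)
  (∈-inst (↑λ e) (inj₁ zero) (inj₁ zero) p fv-var)
I-inst e t s (I-μ i p)   = I-μ
  (I-inst (↑μ e) (λ x → I-rename id suc (t x))
          (λ { zero → [] ; (suc α) → All.map⁺ (All.map (I-rename id suc) (s α)) }) i)
  (∈-inst (↑μ e) (inj₂ zero) (inj₂ zero) p (inj₁ refl))
I-inst e t s (I-⟦⟧ i)    = I-⟦⟧ (I-·* (I-inst e t s i) (s _))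
I-inst e t s (I-app i j) = I-app (I-inst e t s i) (I-inst e t s j)

I-step : {M M′ : Tm l m} → λμI M → M ⟶ M′ → λμI M′
I-step (I-app (I-ƛ i _) j) (β-red M N) = subst λμI (sym ([]≡inst M N))
  (I-inst (βS N) (λ { zero → j ; (suc x) → I-var x }) (λ _ → []) i)
I-step (I-app (I-μ i p) j) (μ-red M N) = subst λμI (cong μ_ (sym (≔ᵣ≡push M (wkμ N)))) (I-μ
  (I-inst (push (wkμ N ∷ [])) I-var (λ { zero → I-rename id suc j ∷ [] ; (suc α) → [] }) i)
  (∈-inst (push (wkμ N ∷ [])) (inj₂ zero) (inj₂ zero) p (inj₁ refl)))
I-step (I-⟦⟧ (I-μ i _)) (ρ-red α M) = I-rename id _ i
I-step (I-μ (I-⟦⟧ i) _) (θ-red M)   = I-rename⁻ id suc M i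
I-step (I-ƛ i p)   (ξƛ s)  = I-ƛ (I-step i s) (fv-step i s (inj₁ zero) p)
I-step (I-μ i p)   (ξμ s)  = I-μ (I-step i s) (fv-step i s (inj₂ zero) p)
I-step (I-⟦⟧ i)    (ξ⟦⟧ s) = I-⟦⟧ (I-step i s)
I-step (I-app i j) (ξˡ s)  = I-app (I-step i s) j
I-step (I-app i j) (ξʳ s)  = I-app i (I-step j s)

I-steps : {M M′ : Tm l m} → λμI M → M ↠ M′ → λμI M′
I-steps i ε       = i
I-steps i (s ◅ σ) = I-steps (I-step i s) σ

-- Compatibility of reduction with substitution

infix 3 _↠⁺_
_↠⁺_ : Tm l m → Tm l m → Set
M ↠⁺ N = ∃ λ K → M ⟶ K × K ↠ N

⟶⇒↠⁺ : {M N : Tm l m} → M ⟶ N → M ↠⁺ N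
⟶⇒↠⁺ s = _ , s , ε

↠⁺⇒↠ : {M N : Tm l m} → M ↠⁺ N → M ↠ N
↠⁺⇒↠ (_ , s , σ) = s ◅ σ

infixr 5 _⁺◅◅_ _◅◅⁺_
_⁺◅◅_ : {L M N : Tm l m} → L ↠⁺ M → M ↠ N → L ↠⁺ N
(_ , s , σ) ⁺◅◅ τ = _ , s , σ ◅◅ τ

_◅◅⁺_ : {L M N : Tm l m} → L ↠ M → M ↠⁺ N → L ↠⁺ N
ε       ◅◅⁺ τ = τ
(s ◅ σ) ◅◅⁺ τ = _ , s , σ ◅◅ ↠⁺⇒↠ τ

⁺-gmap : {M N : Tm l m} (f : Tm l m → Tm l′ m′) → (∀ {M N} → M ⟶ N → f M ⟶ f N) →
         M ↠⁺ N → f M ↠⁺ f N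
⁺-gmap f g (_ , s , σ) = _ , g s , gmap f g σ

-- Successive contractions merge into one `push`: the arguments already absorbed are weakened, so
-- later structural substitutions leave them unchanged.
μ-reds : (M : Tm l (suc m)) (Ps : List (Tm l m)) →
         (μ M) ·* Ps ↠ μ inst (push (map wkμ Ps)) M
μ-reds M [] = subst (μ M ↠_) (cong μ_ (sym (inst-id
  ⟨ (λ _ → refl) , (λ _ → refl) , (λ { zero → refl ; (suc α) → refl }) ⟩ M))) ε
μ-reds M (P ∷ Ps) =
  μ-red M P ·ˢ Ps ◅ subst ((μ (M [ zero ≔ᵣ wkμ P ])) ·* Ps ↠_) (cong μ_ eq) (μ-reds _ Ps)
  where
  open ≡-Reasoning
  d = push (map wkμ Ps)
  eq : inst d (M [ zero ≔ᵣ wkμ P ]) ≡ inst (push (map wkμ (P ∷ Ps))) M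
  eq = begin
    inst d (M [ zero ≔ᵣ wkμ P ])              ≡⟨ cong (inst d) (≔ᵣ≡push M (wkμ P)) ⟩
    inst d (inst (push (wkμ P ∷ [])) M)       ≡⟨ inst-inst d _ M ⟩
    inst (d ⊙ push (wkμ P ∷ [])) M            ≡⟨ inst-cong ⟨ (λ _ → refl) , (λ _ → refl)
        , (λ { zero → cong (_∷ map wkμ Ps) (inst-push-wk _ P) ; (suc α) → refl }) ⟩ M ⟩
    inst (push (map wkμ (P ∷ Ps))) M          ∎

-- Every redex keeps a counterpart, so the image is never empty. It is longer than one step exactly
-- in the ρ case with a nonempty stack, where the μ-contractions of `μ-reds` come first.
inst-step : (e : Subst l m l′ m′) {M M′ : Tm l m} → M ⟶ M′ → inst e M ↠⁺ inst e M′
inst-step e (β-red M N) =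
  subst (inst e ((ƛ M) · N) ↠⁺_) (sym (inst-[] e M N)) (⟶⇒↠⁺ (β-red _ _))
inst-step e (μ-red M N) =
  subst (inst e ((μ M) · N) ↠⁺_) (cong μ_ (sym (inst-≔ᵣ e M N))) (⟶⇒↠⁺ (μ-red _ _))
inst-step e (ρ-red α M) =
  subst (inst e (⟦ α ⟧ μ M) ↠⁺_) (sym (inst-[≔] e M α))
        (gmap ⟦ name e α ⟧_ ξ⟦⟧ (μ-reds (inst (↑μ e) M) (stk e α)) ◅◅⁺ ⟶⇒↠⁺ (ρ-red _ _))
inst-step e (θ-red M) =
  subst (λ U → μ ⟦ zero ⟧ U ↠⁺ inst e M) (sym (inst-wkμ e M)) (⟶⇒↠⁺ (θ-red _))
inst-step e (ξƛ s)  = ⁺-gmap ƛ_ ξƛ (inst-step (↑λ e) s)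
inst-step e (ξμ s)  = ⁺-gmap μ_ ξμ (inst-step (↑μ e) s)
inst-step e (ξ⟦⟧ {α} s) =
  ⁺-gmap (λ U → ⟦ name e α ⟧ (U ·* stk e α)) (λ s → ξ⟦⟧ (s ·ˢ stk e α)) (inst-step e s)
inst-step e (ξˡ s)  = ⁺-gmap (_· _) ξˡ (inst-step e s)
inst-step e (ξʳ s)  = ⁺-gmap (_ ·_) ξʳ (inst-step e s)

inst-steps : (e : Subst l m l′ m′) {M M′ : Tm l m} → M ↠ M′ → inst e M ↠ inst e M′
inst-steps e ε       = ε
inst-steps e (s ◅ σ) = ↠⁺⇒↠ (inst-step e s) ◅◅ inst-steps e σ

rename-steps : (ρ : Fin l → Fin l′) (π : Fin m → Fin m′) {M M′ : Tm l m} →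
               M ↠ M′ → rename ρ π M ↠ rename ρ π M′
rename-steps ρ π {M} {M′} σ rewrite rename≡inst ρ π M | rename≡inst ρ π M′ =
  inst-steps (ren ρ π) σ

rename-steps⁺ : (ρ : Fin l → Fin l′) (π : Fin m → Fin m′) {M M′ : Tm l m} →
                M ↠⁺ M′ → rename ρ π M ↠⁺ rename ρ π M′
rename-steps⁺ ρ π {M} {M′} (_ , s , σ) rewrite rename≡inst ρ π M | rename≡inst ρ π M′ =
  inst-step (ren ρ π) s ⁺◅◅ inst-steps (ren ρ π) σ

appˡʳ : {M M′ N N′ : Tm l m} → M ↠ M′ → N ↠ N′ → M · N ↠ M′ · N′
appˡʳ σ τ = gmap (_· _) ξˡ σ ◅◅ gmap (_ ·_) ξʳ τ

appˡ⁺ : {M M′ N N′ : Tm l m} → M ↠⁺ M′ → N ↠ N′ → M · N ↠⁺ M′ · N′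
appˡ⁺ σ τ = ⁺-gmap (_· _) ξˡ σ ⁺◅◅ gmap (_ ·_) ξʳ τ

appʳ⁺ : {M M′ N N′ : Tm l m} → M ↠ M′ → N ↠⁺ N′ → M · N ↠⁺ M′ · N′
appʳ⁺ σ τ = gmap (_· _) ξˡ σ ◅◅⁺ ⁺-gmap (_ ·_) ξʳ τ

extS-steps : {s s′ : Fin l → Tm l′ m} → (∀ x → s x ↠ s′ x) → ∀ x → extS s x ↠ extS s′ x
extS-steps r zero    = ε
extS-steps r (suc x) = rename-steps suc id (r x)

sub-steps : {s s′ : Fin l → Tm l′ m} → (∀ x → s x ↠ s′ x) → ∀ M → sub s M ↠ sub s′ M
sub-steps r (var x)   = r x
sub-steps r (ƛ M)     = ƛ* (sub-steps (extS-steps r) M)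
sub-steps r (μ M)     = μ* (sub-steps (λ x → rename-steps id suc (r x)) M)
sub-steps r (⟦ α ⟧ M) = ⟦ α ⟧* (sub-steps r M)
sub-steps r (M · N)   = appˡʳ (sub-steps r M) (sub-steps r N)

-- The given occurrence of x contributes at least one step; all other occurrences may contribute any
-- number, possibly none.
sub-steps⁺ : {s s′ : Fin l → Tm l′ m} → (∀ x → s x ↠ s′ x) →
             ∀ {x M} → x ∈Fvλ M → s x ↠⁺ s′ x → sub s M ↠⁺ sub s′ M
sub-steps⁺ r fv-var r⁺ = r⁺
sub-steps⁺ r (fv-ƛ p) r⁺ = ⁺-gmap ƛ_ ξƛ (sub-steps⁺ (extS-steps r) p (rename-steps⁺ suc id r⁺))
sub-steps⁺ r (fv-μ p) r⁺ =
  ⁺-gmap μ_ ξμ (sub-steps⁺ (λ x → rename-steps id suc (r x)) p (rename-steps⁺ id suc r⁺))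
sub-steps⁺ r (fv-⟦⟧ p) r⁺ = ⁺-gmap ⟦ _ ⟧_ ξ⟦⟧ (sub-steps⁺ r p r⁺)
sub-steps⁺ r (fv-appˡ {N = N} p) r⁺ = appˡ⁺ (sub-steps⁺ r p r⁺) (sub-steps r N)
sub-steps⁺ r (fv-appʳ {M = M} p) r⁺ = appʳ⁺ (sub-steps r M) (sub-steps⁺ r p r⁺)

≔ᵣ-steps : {N N′ : Tm l m} (α : Fin m) (M : Tm l m) → N ↠ N′ → M [ α ≔ᵣ N ] ↠ M [ α ≔ᵣ N′ ]
≔ᵣ-steps α (var x)   r = ε
≔ᵣ-steps α (ƛ M)     r = ƛ* (≔ᵣ-steps α M (rename-steps suc id r))
≔ᵣ-steps α (μ M)     r = μ* (≔ᵣ-steps (suc α) M (rename-steps id suc r))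
≔ᵣ-steps α (⟦ β ⟧ M) r with β ≟ α
... | yes _ = ⟦ β ⟧* (appˡʳ (≔ᵣ-steps α M r) r)
... | no  _ = ⟦ β ⟧* (≔ᵣ-steps α M r)
≔ᵣ-steps α (M · N)   r = appˡʳ (≔ᵣ-steps α M r) (≔ᵣ-steps α N r)

≔ᵣ-steps⁺ : {N N′ : Tm l m} {α : Fin m} {M : Tm l m} → α ∈Fvμ M → N ↠⁺ N′ →
            M [ α ≔ᵣ N ] ↠⁺ M [ α ≔ᵣ N′ ]
≔ᵣ-steps⁺ {α = α} (fv-name {M}) r with α ≟ α
... | yes _  = ⁺-gmap ⟦ α ⟧_ ξ⟦⟧ (appʳ⁺ (≔ᵣ-steps α M (↠⁺⇒↠ r)) r)
... | no α≢α = contradiction refl α≢α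
≔ᵣ-steps⁺ {α = α} (fv-⟦⟧ {β} p) r with β ≟ α
... | yes _ = ⁺-gmap ⟦ β ⟧_ ξ⟦⟧ (appˡ⁺ (≔ᵣ-steps⁺ p r) (↠⁺⇒↠ r))
... | no  _ = ⁺-gmap ⟦ β ⟧_ ξ⟦⟧ (≔ᵣ-steps⁺ p r)
≔ᵣ-steps⁺ (fv-ƛ p) r = ⁺-gmap ƛ_ ξƛ (≔ᵣ-steps⁺ p (rename-steps⁺ suc id r))
≔ᵣ-steps⁺ (fv-μ p) r = ⁺-gmap μ_ ξμ (≔ᵣ-steps⁺ p (rename-steps⁺ id suc r))
≔ᵣ-steps⁺ {α = α} (fv-appˡ {N = N} p) r = appˡ⁺ (≔ᵣ-steps⁺ p r) (≔ᵣ-steps α N (↠⁺⇒↠ r))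
≔ᵣ-steps⁺ {α = α} (fv-appʳ {M = M} p) r = appʳ⁺ (≔ᵣ-steps α M (↠⁺⇒↠ r)) (≔ᵣ-steps⁺ p r)

[]-stepˡ : {M M′ : Tm (suc l) m} {N : Tm l m} → M ⟶ M′ → M [ N ] ↠⁺ M′ [ N ]
[]-stepˡ {M = M} {M′} {N} s rewrite []≡inst M N | []≡inst M′ N = inst-step (βS N) s

[]-stepʳ : {M : Tm (suc l) m} {N N′ : Tm l m} → zero ∈Fvλ M → N ⟶ N′ → M [ N ] ↠⁺ M [ N′ ]
[]-stepʳ 0∈M s =
  sub-steps⁺ (λ { zero → s ◅ ε ; (suc x) → ε }) 0∈M (⟶⇒↠⁺ s)

≔ᵣ-stepˡ : {M M′ : Tm l (suc m)} {N : Tm l (suc m)} → M ⟶ M′ →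
           M [ zero ≔ᵣ N ] ↠⁺ M′ [ zero ≔ᵣ N ]
≔ᵣ-stepˡ {M = M} {M′} {N} s rewrite ≔ᵣ≡push M N | ≔ᵣ≡push M′ N = inst-step (push (N ∷ [])) s

[≔]-step : {M M′ : Tm l (suc m)} {α : Fin m} → M ⟶ M′ → M [≔ α ] ↠⁺ M′ [≔ α ]
[≔]-step s = rename-steps⁺ id _ (⟶⇒↠⁺ s)

wkμ-[≔] : (M : Tm l m) (α : Fin m) → wkμ M [≔ α ] ≡ M
wkμ-[≔] M α = trans ([≔]≡inst (wkμ M) α) (inst-ρ-wk α M)

≔ᵣ-wkμ : (M : Tm l m) (N : Tm l (suc m)) → wkμ M [ zero ≔ᵣ N ] ≡ wkμ M
≔ᵣ-wkμ M N = trans (≔ᵣ≡push (wkμ M) N) (inst-push-wk _ M)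

-- Inversion of reduction steps

-- The θ-shape is returned as an equation: if the body is a concrete term such as a renaming,
-- matching on `θ-red` directly would have to unify it with the function application `wkμ Q`.
inv-μ : {M : Tm l (suc m)} {Q : Tm l m} → μ M ⟶ Q →
        M ≡ ⟦ zero ⟧ wkμ Q ⊎ ∃ λ M′ → (M ⟶ M′) × Q ≡ μ M′
inv-μ (θ-red M) = inj₁ refl
inv-μ (ξμ s)    = inj₂ (_ , s , refl)

inv-⟦⟧ : {α : Fin m} {M Q : Tm l m} → ⟦ α ⟧ M ⟶ Q →
         (∃ λ M₀ → M ≡ μ M₀ × Q ≡ M₀ [≔ α ]) ⊎ ∃ λ M′ → (M ⟶ M′) × Q ≡ ⟦ α ⟧ M′
inv-⟦⟧ (ρ-red α M) = inj₁ (M , refl , refl)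
inv-⟦⟧ (ξ⟦⟧ s)     = inj₂ (_ , s , refl)

data App {l m} (M N Q : Tm l m) : Set where
  app-β : ∀ M₀ → M ≡ ƛ M₀ → Q ≡ M₀ [ N ] → App M N Q
  app-μ : ∀ M₀ → M ≡ μ M₀ → Q ≡ μ (M₀ [ zero ≔ᵣ wkμ N ]) → App M N Q
  app-ˡ : ∀ {M′} → M ⟶ M′ → Q ≡ M′ · N → App M N Q
  app-ʳ : ∀ {N′} → N ⟶ N′ → Q ≡ M · N′ → App M N Q

inv-· : {M N Q : Tm l m} → M · N ⟶ Q → App M N Q
inv-· (β-red M N) = app-β M refl refl
inv-· (μ-red M N) = app-μ M refl refl
inv-· (ξˡ s)      = app-ˡ s refl
inv-· (ξʳ s)      = app-ʳ s refl

-- Reflection of steps along renamings.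

rename-cong : {ρ ρ′ : Fin l → Fin l′} {π π′ : Fin m → Fin m′} →
              ρ ≗ ρ′ → π ≗ π′ → rename ρ π ≗ rename ρ′ π′
rename-cong p q M = trans (rename≡inst _ _ M)
  (trans (inst-cong ⟨ (λ x → cong var (p x)) , q , (λ _ → refl) ⟩ M) (sym (rename≡inst _ _ M)))

rename-[≔] : (ρ : Fin l → Fin l′) (π : Fin m → Fin m′) (M : Tm l (suc m)) (α : Fin m) →
             rename ρ π (M [≔ α ]) ≡ rename ρ (ext π) M [≔ π α ]
rename-[≔] ρ π M α = trans (rename-rename ρ π id _ M)
  (trans (rename-cong (λ _ → refl) (λ { zero → refl ; (suc β) → refl }) M)
         (sym (rename-rename id _ ρ (ext π) M)))

rename-[] : (ρ : Fin l → Fin l′) (π : Fin m → Fin m′) (M : Tm (suc l) m) (N : Tm l m) →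
            rename ρ π (M [ N ]) ≡ rename (ext ρ) π M [ rename ρ π N ]
rename-[] ρ π M N = begin
  rename ρ π (M [ N ])                             ≡⟨ rename≡inst ρ π _ ⟩
  inst (ren ρ π) (M [ N ])                         ≡⟨ inst-[] (ren ρ π) M N ⟩
  inst (↑λ (ren ρ π)) M [ inst (ren ρ π) N ]
    ≡⟨ cong₂ _[_] (trans (rename≡inst (ext ρ) π M) (inst-cong (↑λ-ren ρ π) M))
                  (rename≡inst ρ π N) ⟨
  rename (ext ρ) π M [ rename ρ π N ]              ∎
  where open ≡-Reasoning

rename-≔ᵣ : (ρ : Fin l → Fin l′) (π : Fin m → Fin m′) (M : Tm l (suc m)) (N : Tm l m) →
            rename ρ (ext π) (M [ zero ≔ᵣ wkμ N ]) ≡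
            rename ρ (ext π) M [ zero ≔ᵣ wkμ (rename ρ π N) ]
rename-≔ᵣ ρ π M N = begin
  rename ρ (ext π) (M [ zero ≔ᵣ wkμ N ])           ≡⟨ under (M [ zero ≔ᵣ wkμ N ]) ⟩
  inst (↑μ (ren ρ π)) (M [ zero ≔ᵣ wkμ N ])        ≡⟨ inst-≔ᵣ (ren ρ π) M N ⟩
  inst (↑μ (ren ρ π)) M [ zero ≔ᵣ wkμ (inst (ren ρ π) N) ]
    ≡⟨ cong₂ (λ U V → U [ zero ≔ᵣ wkμ V ]) (under M) (rename≡inst ρ π N) ⟨
  rename ρ (ext π) M [ zero ≔ᵣ wkμ (rename ρ π N) ] ∎
  where
  open ≡-Reasoning
  under : rename ρ (ext π) ≗ inst (↑μ (ren ρ π))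
  under U = trans (rename≡inst ρ (ext π) U) (inst-cong (↑μ-ren ρ π) U)

rename-wkμ : (ρ : Fin l → Fin l′) (π : Fin m → Fin m′) →
             rename ρ (ext π) ∘ wkμ ≗ wkμ ∘ rename ρ π
rename-wkμ ρ π M = trans (rename-rename ρ (ext π) id suc M) (sym (rename-rename id suc ρ π M))

Reflected : (Fin l → Fin l′) → (Fin m → Fin m′) → Tm l m → Tm l′ m′ → Set
Reflected ρ π M Q = ∃ λ M′ → (M ⟶ M′) × Q ≡ rename ρ π M′

-- Even a renaming that identifies variables creates no redex. For θ, `ext π` takes the value zero
-- only at zero, so the bound name and its absence from the body are both reflected.
rename-step⁻ : (ρ : Fin l → Fin l′) (π : Fin m → Fin m′) (M : Tm l m) {Q : Tm l′ m′} →
               rename ρ π M ⟶ Q → Reflected ρ π M Q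
rename-step⁻ ρ π (ƛ M) (ξƛ s) =
  let M′ , s′ , eq = rename-step⁻ (ext ρ) π M s in ƛ M′ , ξƛ s′ , cong ƛ_ eq
rename-step⁻ ρ π (μ M) {Q} s with inv-μ s
... | inj₂ (_ , s₁ , refl) =
  let M′ , s′ , eq = rename-step⁻ ρ (ext π) M s₁ in μ M′ , ξμ s′ , cong μ_ eq
... | inj₁ eq = θ M eq
  where
  θ : ∀ M → rename ρ (ext π) M ≡ ⟦ zero ⟧ wkμ Q → Reflected ρ π (μ M) Q
  θ (⟦ suc γ ⟧ M₀) eq with () ← ⟦⟧-injective eq
  θ (⟦ zero ⟧ M₀) eq with ⟦⟧-injective eq
  ... | _ , eq′ with zero∉⇒wkμ M₀ (λ p → zero∉wkμ (subst (zero ∈Fvμ_) eq′ (fvμ-rename ρ (ext π) p)))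
  ... | M₁ , refl = M₁ , θ-red M₁ , wkμ-injective (trans (sym eq′) (rename-wkμ ρ π M₁))
rename-step⁻ ρ π (⟦ α ⟧ M) {Q} s with inv-⟦⟧ s
... | inj₂ (_ , s₁ , refl) =
  let M′ , s′ , eq = rename-step⁻ ρ π M s₁ in ⟦ α ⟧ M′ , ξ⟦⟧ s′ , cong ⟦ _ ⟧_ eq
... | inj₁ (M₁ , eq₁ , eq₂) = ρ′ M eq₁
  where
  ρ′ : ∀ M → rename ρ π M ≡ μ M₁ → Reflected ρ π (⟦ α ⟧ M) Q
  ρ′ (μ M₀) refl = M₀ [≔ α ] , ρ-red α M₀ , trans eq₂ (sym (rename-[≔] ρ π M₀ α))
rename-step⁻ ρ π (M · N) {Q} s with inv-· s
... | app-ˡ s₁ refl =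
  let M′ , s′ , eq = rename-step⁻ ρ π M s₁ in M′ · N , ξˡ s′ , cong (_· _) eq
... | app-ʳ s₁ refl =
  let N′ , s′ , eq = rename-step⁻ ρ π N s₁ in M · N′ , ξʳ s′ , cong (_ ·_) eq
... | app-β M₁ eq₁ eq₂ = β M eq₁
  where
  β : ∀ M → rename ρ π M ≡ ƛ M₁ → Reflected ρ π (M · N) Q
  β (ƛ M₀) refl = M₀ [ N ] , β-red M₀ N , trans eq₂ (sym (rename-[] ρ π M₀ N))
... | app-μ M₁ eq₁ eq₂ = μ′ M eq₁
  where
  μ′ : ∀ M → rename ρ π M ≡ μ M₁ → Reflected ρ π (M · N) Q
  μ′ (μ M₀) refl =
    μ (M₀ [ zero ≔ᵣ wkμ N ]) , μ-red M₀ N , trans eq₂ (cong μ_ (sym (rename-≔ᵣ ρ π M₀ N)))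

rename-steps⁻ : (ρ : Fin l → Fin l′) (π : Fin m → Fin m′) (M : Tm l m) {Q : Tm l′ m′} →
                rename ρ π M ↠ Q → ∃ λ M′ → (M ↠ M′) × Q ≡ rename ρ π M′
rename-steps⁻ ρ π M ε       = M , ε , refl
rename-steps⁻ ρ π M (s ◅ σ) with rename-step⁻ ρ π M s
... | M₁ , s′ , refl = let M′ , σ′ , eq = rename-steps⁻ ρ π M₁ σ in M′ , s′ ◅ σ′ , eq

-- Leftmost steps

-- The part `x M₁ ⋯ Mⱼ` of a spine that precedes the first argument still to be reduced.
data Ne {l m} : Tm l m → Set where
  ne-var : ∀ x → Ne (var x)
  ne-·   : ∀ {M N} → Ne M → NF N → Ne (M · N)

NF-Ne : {M : Tm l m} → Ne M → NF M
NF-Ne (ne-· ne nf) (ξˡ s) = NF-Ne ne s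
NF-Ne (ne-· ne nf) (ξʳ s) = nf s

data Hd {l m} : {M N : Tm l m} → M ⟶ N → Set where
  hd-β : ∀ {M N} → Hd (β-red M N)
  hd-μ : ∀ {M N} → Hd (μ-red M N)
  hd-ˡ : ∀ {M M′ N} {s : M ⟶ M′} → Hd s → Hd (ξˡ {N = N} s)

-- LM describes the steps selected by LR by recursion on the binary application,
-- so that it can be inverted without spines in the indices; Hd covers the case of
-- a head redex, Ar that of a head variable.
data LM {l m : ℕ} : {M N : Tm l m} → M ⟶ N → Set

data Ar {l m : ℕ} : {M N : Tm l m} → M ⟶ N → Set where
  ar-ʳ : ∀ {M N N′} {s : N ⟶ N′} → Ne M → LM s → Ar (ξʳ {M = M} s)
  ar-ˡ : ∀ {M M′ N} {s : M ⟶ M′} → Ar s → Ar (ξˡ {N = N} s)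

data LM {l} {m} where
  lm-ƛ  : ∀ {M N} {s : M ⟶ N} → LM s → LM (ξƛ s)
  lm-θ  : ∀ M → LM (θ-red M)
  lm-μ  : ∀ {M N} {s : M ⟶ N} → ¬ θRedex (μ M) → LM s → LM (ξμ s)
  lm-ρ  : ∀ α M → LM (ρ-red α M)
  lm-⟦⟧ : ∀ {α M N} {s : M ⟶ N} → ¬ ρRedex (⟦ α ⟧ M) → LM s → LM (ξ⟦⟧ {α = α} s)
  lm-hd : ∀ {M N} {s : M ⟶ N} → Hd s → LM s
  lm-ar : ∀ {M N} {s : M ⟶ N} → Ar s → LM s

-- `Ps` collects the arguments passed on the way to the head; `s ·ˢ (P ∷ Ps)` unfolds to
-- `ξˡ s ·ˢ Ps`, which turns the binary view back into the spine of `LR`.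
hd⇒LR : {M N : Tm l m} {s : M ⟶ N} → Hd s → ∀ Ps → LR (s ·ˢ Ps)
hd⇒LR hd-β     Ps = lr-β _ _ Ps
hd⇒LR hd-μ     Ps = lr-μ· _ _ Ps
hd⇒LR (hd-ˡ h) Ps = hd⇒LR h (_ ∷ Ps)

Ne⇒spine : {M : Tm l m} → Ne M → ∃ λ x → ∃ λ Ms → M ≡ var x ·* Ms × All NF Ms
Ne⇒spine (ne-var x) = x , [] , refl , []
Ne⇒spine (ne-· ne nf) with Ne⇒spine ne
... | x , Ms , refl , nfs =
  x , Ms ++ _ ∷ [] , sym (foldl-++ _·_ (var x) Ms _) , All.++⁺ nfs (nf ∷ [])

LM⇒LR : {M N : Tm l m} {s : M ⟶ N} → LM s → LR s
ar⇒LR : {M N : Tm l m} {s : M ⟶ N} → Ar s → ∀ Ps → LR (s ·ˢ Ps)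

LM⇒LR (lm-ƛ p)     = lr-ƛ (LM⇒LR p)
LM⇒LR (lm-θ M)     = lr-θ M
LM⇒LR (lm-μ ¬θ p)  = lr-μ ¬θ (LM⇒LR p)
LM⇒LR (lm-ρ α M)   = lr-ρ α M
LM⇒LR (lm-⟦⟧ ¬ρ p) = lr-⟦⟧ ¬ρ (LM⇒LR p)
LM⇒LR (lm-hd h)    = hd⇒LR h []
LM⇒LR (lm-ar a)    = ar⇒LR a []

ar⇒LR (ar-ʳ ne p) Ps with Ne⇒spine ne
... | x , Ms , refl , nfs = lr-var x Ps nfs (LM⇒LR p)
ar⇒LR (ar-ˡ a)    Ps = ar⇒LR a (_ ∷ Ps)

-- A property of terms that holds neither of variables, abstractions nor
-- applications, and that no step below a prefix μα or [α] creates: only the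
-- contraction of a redex at the root can establish it.
record Rooted {l m} (X : Tm l m → Set) : Set where
  field
    ¬var    : ∀ {x} → ¬ X (var x)
    ¬ƛ      : ∀ {M} → ¬ X (ƛ M)
    ¬·      : ∀ {M N} → ¬ X (M · N)
    μ-back  : ∀ {M M′} → λμI M → M ⟶ M′ → X (μ M′) → X (μ M)
    ⟦⟧-back : ∀ {α M M′} → λμI M → M ⟶ M′ → X (⟦ α ⟧ M′) → X (⟦ α ⟧ M)

open Rooted

isμ : Tm l m → Set
isμ M = ∃ λ M₀ → M ≡ μ M₀

isμ-rooted : Rooted (isμ {l} {m})
isμ-rooted = record
  { ¬var = λ { (_ , ()) } ; ¬ƛ = λ { (_ , ()) } ; ¬· = λ { (_ , ()) }
  ; μ-back = λ _ _ _ → _ , refl ; ⟦⟧-back = λ { _ _ (_ , ()) } }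

θ-rooted : Rooted (λ (M : Tm l (suc m)) → θRedex (μ M))
θ-rooted {l} {m} = record
  { ¬var = λ { (_ , ()) } ; ¬ƛ = λ { (_ , ()) } ; ¬· = λ { (_ , ()) }
  ; μ-back = λ { _ _ (_ , ()) } ; ⟦⟧-back = back }
  where
  back : ∀ {α} {M M′ : Tm l (suc m)} → λμI M → M ⟶ M′ →
         θRedex (μ ⟦ α ⟧ M′) → θRedex (μ ⟦ α ⟧ M)
  -- An occurrence of index zero in `M` would survive the step and lie in a weakened term.
  back {M = M} i s (_ , refl) with zero∉⇒wkμ M (λ p → zero∉wkμ (fv-step i s (inj₂ zero) p))
  ... | M₀ , refl = M₀ , refl

LM-θ : {P L : Tm l m} {s : P ⟶ L} {M : Tm l m} → LM s → P ≡ μ ⟦ zero ⟧ wkμ M → L ≡ M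
LM-θ (lm-θ M)      eq = wkμ-injective (proj₂ (⟦⟧-injective (μ-injective eq)))
LM-θ (lm-μ ¬θ _)   eq = contradiction (_ , eq) ¬θ
LM-θ (lm-hd hd-β) ()
LM-θ (lm-hd hd-μ) ()
LM-θ (lm-hd (hd-ˡ _)) ()
LM-θ (lm-ar (ar-ʳ _ _)) ()
LM-θ (lm-ar (ar-ˡ _)) ()

-- A redex at the root is the leftmost one, or the term is an application, where a step inside
-- cannot establish X. This is what transports the side conditions of `lm-μ` and `lm-⟦⟧` along a
-- step.
LM-rooted : {X : Tm l m → Set} → Rooted X → {M M′ L : Tm l m} {s : M ⟶ L} →
            λμI M → M ⟶ M′ → LM s → L ≡ M′ ⊎ (X M′ → X M)
LM-rooted R i (β-red M N) (lm-hd hd-β) = inj₁ refl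
LM-rooted R i (β-red M N) (lm-hd (hd-ˡ ()))
LM-rooted R i (β-red M N) (lm-ar (ar-ˡ ()))
LM-rooted R i (μ-red M N) (lm-hd hd-μ) = inj₁ refl
LM-rooted R i (μ-red M N) (lm-hd (hd-ˡ ()))
LM-rooted R i (μ-red M N) (lm-ar (ar-ˡ ()))
LM-rooted R i (ρ-red α M) (lm-ρ α M) = inj₁ refl
LM-rooted R i (ρ-red α M) (lm-⟦⟧ ¬ρ _) = contradiction (_ , _ , refl) ¬ρ
LM-rooted R i (θ-red M) p = inj₁ (LM-θ p refl)
LM-rooted R i (ξƛ t) p = inj₂ (λ x → contradiction x (¬ƛ R))
LM-rooted R (I-μ i _) (ξμ t) p = inj₂ (μ-back R i t)
LM-rooted R (I-⟦⟧ i) (ξ⟦⟧ t) p = inj₂ (⟦⟧-back R i t)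
LM-rooted R i (ξˡ t) p = inj₂ (λ x → contradiction x (¬· R))
LM-rooted R i (ξʳ t) p = inj₂ (λ x → contradiction x (¬· R))

-- Leftmost steps against arbitrary steps

-- The kind `S` is a parameter because a step put back under a further application must be known to
-- be a head step, or a step in an argument of a head variable; `LM` alone would not allow that.
Join : (∀ {M N : Tm l m} → M ⟶ N → Set) → Tm l m → Tm l m → Set
Join S L M′ = L ↠ M′ ⊎ ∃ λ L′ → (L ↠⁺ L′) × ∃ λ (s : M′ ⟶ L′) → S s

diamond-Hd : {M M′ L : Tm l m} {s : M ⟶ L} → λμI M → Hd s → M ⟶ M′ → Join Hd L M′
diamond-Hd i hd-β (β-red M N) = inj₁ ε
diamond-Hd i hd-β (ξˡ (ξƛ t)) = inj₂ (_ , []-stepˡ t , β-red _ _ , hd-β)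
diamond-Hd (I-app (I-ƛ _ 0∈M) _) (hd-β {M}) (ξʳ t) =
  inj₂ (_ , []-stepʳ {M = M} 0∈M t , β-red _ _ , hd-β)
diamond-Hd i hd-μ (μ-red M N) = inj₁ ε
diamond-Hd i (hd-μ {N = N}) (ξˡ {M′ = Q} t) with inv-μ t
-- Critical pair `(μα.[α]Q) N` with α not free in Q: the μ-contraction yields `μα.[α](Q N)`, one
-- θ-step away from `Q N`.
... | inj₁ refl = inj₁ (subst (λ U → μ ⟦ zero ⟧ (U · wkμ N) ↠ Q · N)
                              (sym (≔ᵣ-wkμ Q (wkμ N))) (θ-red (Q · N) ◅ ε))
... | inj₂ (_ , t₁ , refl) = inj₂ (_ , ⁺-gmap μ_ ξμ (≔ᵣ-stepˡ t₁) , μ-red _ _ , hd-μ)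
diamond-Hd (I-app (I-μ _ 0∈M) _) hd-μ (ξʳ t) =
  inj₂ (_ , ⁺-gmap μ_ ξμ (≔ᵣ-steps⁺ 0∈M (rename-steps⁺ id suc (⟶⇒↠⁺ t))) , μ-red _ _ , hd-μ)
diamond-Hd (I-app i _) (hd-ˡ h) (ξˡ t) with diamond-Hd i h t
... | inj₁ σ                 = inj₁ (gmap (_· _) ξˡ σ)
... | inj₂ (_ , σ , s , h′)  = inj₂ (_ , ⁺-gmap (_· _) ξˡ σ , ξˡ s , hd-ˡ h′)
diamond-Hd i (hd-ˡ {s = s} h) (ξʳ t) = inj₂ (_ , ⟶⇒↠⁺ (ξʳ t) , ξˡ s , hd-ˡ h)

diamond-Ar : {M M′ L : Tm l m} {s : M ⟶ L} → λμI M → Ar s → M ⟶ M′ → Join Ar L M′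
diamond : {M M′ L : Tm l m} {s : M ⟶ L} → λμI M → LM s → M ⟶ M′ → Join LM L M′

diamond-Ar i (ar-ʳ ne p) (ξˡ t) = contradiction t (NF-Ne ne)
diamond-Ar (I-app _ i) (ar-ʳ ne p) (ξʳ t) with diamond i p t
... | inj₁ σ                = inj₁ (gmap (_ ·_) ξʳ σ)
... | inj₂ (_ , σ , s , p′) = inj₂ (_ , ⁺-gmap (_ ·_) ξʳ σ , ξʳ s , ar-ʳ ne p′)
diamond-Ar (I-app i _) (ar-ˡ a) (ξˡ t) with diamond-Ar i a t
... | inj₁ σ                = inj₁ (gmap (_· _) ξˡ σ)
... | inj₂ (_ , σ , s , a′) = inj₂ (_ , ⁺-gmap (_· _) ξˡ σ , ξˡ s , ar-ˡ a′)
diamond-Ar i (ar-ˡ {s = s} a) (ξʳ t) = inj₂ (_ , ⟶⇒↠⁺ (ξʳ t) , ξˡ s , ar-ˡ a)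

diamond (I-ƛ i _) (lm-ƛ p) (ξƛ t) with diamond i p t
... | inj₁ σ                = inj₁ (ƛ* σ)
... | inj₂ (_ , σ , s , p′) = inj₂ (_ , ⁺-gmap ƛ_ ξƛ σ , ξƛ s , lm-ƛ p′)
diamond i (lm-θ K) t with inv-μ t
... | inj₁ eq = inj₁ (subst (K ↠_) (wkμ-injective (proj₂ (⟦⟧-injective eq))) ε)
... | inj₂ (_ , t₁ , refl) with inv-⟦⟧ t₁
... | inj₂ (_ , t₂ , refl) with rename-step⁻ id suc K t₂
... | K′ , t₃ , refl = inj₂ (K′ , ⟶⇒↠⁺ t₃ , θ-red K′ , lm-θ K′)
-- Critical pair `μα.[α]μβ.J` with α not free in `μβ.J`: the inner ρ-contraction merely renames β to
-- α, so both sides are the same term.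
diamond i (lm-θ K) t | inj₂ (_ , t₁ , refl) | inj₁ (J , eq , refl) = inj₁ (collapse K eq)
  where
  collapse : ∀ K → wkμ K ≡ μ J → K ↠ μ (J [≔ zero ])
  collapse (μ K₀) refl = subst (μ K₀ ↠_) (cong μ_ (sym (trans (rename-rename id _ id (ext suc) K₀)
    (trans (rename≡inst id _ K₀)
      (inst-id ⟨ (λ _ → refl) , (λ { zero → refl ; (suc α) → refl }) , (λ _ → refl) ⟩ K₀))))) ε
diamond i (lm-μ ¬θ p) t with inv-μ t
... | inj₁ refl = contradiction (_ , refl) ¬θ
-- Either the step is the leftmost one, or it leaves the prefix without a θ-redex and the next
-- leftmost step is again below it.
diamond (I-μ i _) (lm-μ ¬θ p) _ | inj₂ (_ , t , refl) with LM-rooted θ-rooted i t p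
... | inj₁ refl = inj₁ ε
... | inj₂ back with diamond i p t
... | inj₁ σ                = inj₁ (μ* σ)
... | inj₂ (_ , σ , s , p′) = inj₂ (_ , ⁺-gmap μ_ ξμ σ , ξμ s , lm-μ (¬θ ∘ back) p′)
diamond i (lm-ρ α M) t with inv-⟦⟧ t
... | inj₁ (_ , refl , refl) = inj₁ ε
... | inj₂ (Q , t₁ , refl) with inv-μ t₁
-- Critical pair `[α]μβ.[β]Q` with β not free in Q: both contractions give `[α]Q`.
... | inj₁ refl = inj₁ (subst (λ U → ⟦ α ⟧ U ↠ ⟦ α ⟧ Q) (sym (wkμ-[≔] Q α)) ε)
... | inj₂ (M′ , t₂ , refl) = inj₂ (_ , [≔]-step t₂ , ρ-red α M′ , lm-ρ α M′)
diamond (I-⟦⟧ i) (lm-⟦⟧ ¬ρ p) t with inv-⟦⟧ t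
... | inj₁ (_ , refl , refl) = contradiction (_ , _ , refl) ¬ρ
... | inj₂ (_ , t₁ , refl) with LM-rooted isμ-rooted i t₁ p
... | inj₁ refl = inj₁ ε
... | inj₂ back with diamond i p t₁
... | inj₁ σ                = inj₁ (⟦ _ ⟧* σ)
... | inj₂ (_ , σ , s , p′) = inj₂ (_ , ⁺-gmap ⟦ _ ⟧_ ξ⟦⟧ σ , ξ⟦⟧ s , lm-⟦⟧ ¬ρ′ p′)
  where
  ¬ρ′ : ¬ ρRedex (⟦ _ ⟧ _)
  ¬ρ′ (_ , _ , refl) with back (_ , refl)
  ... | _ , refl = ¬ρ (_ , _ , refl)
diamond i (lm-hd h) t with diamond-Hd i h t
... | inj₁ σ                = inj₁ σ
... | inj₂ (_ , σ , s , h′) = inj₂ (_ , σ , s , lm-hd h′)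
diamond i (lm-ar a) t with diamond-Ar i a t
... | inj₁ σ                = inj₁ σ
... | inj₂ (_ , σ , s , a′) = inj₂ (_ , σ , s , lm-ar a′)

-- The length of the leftmost sequence as a measure.

infix 4 _⇓_
data _⇓_ {l m} : Tm l m → ℕ → Set where
  nf   : ∀ {M} → NF M → M ⇓ 0
  step : ∀ {M L k} {s : M ⟶ L} → LM s → L ⇓ k → M ⇓ suc k

-- The bound `b` carries the recursion, since the lengths handed to `descend*` are results of
-- earlier calls and not structurally smaller than k. A leftmost normalization of M′ is produced
-- along with its length.
descend  : ∀ b {k} {M M′ : Tm l m} → k ≤ b → λμI M → M ⇓ k → M ⟶ M′ → ∃ λ k′ → k′ < k × M′ ⇓ k′
descend* : ∀ b {k} {M M′ : Tm l m} → k ≤ b → λμI M → M ⇓ k → M ↠ M′ → ∃ λ k′ → k′ ≤ k × M′ ⇓ k′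

descend b       k≤b       i (nf M-nf) t = contradiction t M-nf
descend (suc b) (s≤s k≤b) i (step {s = s} p L⇓) t with diamond i p t
... | inj₁ σ with descend* b k≤b (I-step i s) L⇓ σ
... | k′ , k′≤k , M′⇓ = k′ , s≤s k′≤k , M′⇓
descend (suc b) (s≤s k≤b) i (step {s = s} p L⇓) t | inj₂ (L′ , (_ , t₁ , σ) , _ , p′)
  with descend b k≤b (I-step i s) L⇓ t₁
... | k₁ , k₁<k , L₁⇓
  with descend* b (≤-trans (<⇒≤ k₁<k) k≤b) (I-step (I-step i s) t₁) L₁⇓ σ
-- The successor counts the leftmost step from M′ to L′; the first step out of L has already lowered
-- the length, so the inequality stays strict.
... | k′ , k′≤k₁ , L′⇓ = suc k′ , s≤s (≤-<-trans k′≤k₁ k₁<k) , step p′ L′⇓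

descend* b k≤b i M⇓ ε       = _ , ≤-refl , M⇓
descend* b k≤b i M⇓ (t ◅ σ) with descend b k≤b i M⇓ t
... | k₁ , k₁<k , M₁⇓ with descend* b (≤-trans (<⇒≤ k₁<k) k≤b) (I-step i t) M₁⇓ σ
... | k′ , k′≤k₁ , M′⇓ = k′ , ≤-trans k′≤k₁ (<⇒≤ k₁<k) , M′⇓

⇓-bounds : ∀ {k} {M N : Tm l m} → λμI M → M ⇓ k → (τ : M ↠ N) → ∣ τ ∣ ≤ k
⇓-bounds i M⇓ ε       = z≤n
⇓-bounds i M⇓ (t ◅ τ) with descend _ ≤-refl i M⇓ t
... | k′ , k′<k , M′⇓ = ≤-<-trans (⇓-bounds (I-step i t) M′⇓ τ) k′<k

-- Standard sequences

infixr 5 _◅_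
data Every {l m} (S : ∀ {M N : Tm l m} → M ⟶ N → Set) {N : Tm l m} :
           {M : Tm l m} → M ↠ N → Set where
  ε   : Every S ε
  _◅_ : ∀ {M M′} {s : M ⟶ M′} {σ : M′ ↠ N} → S s → Every S σ → Every S (s ◅ σ)

Every-◅◅ : {S : ∀ {M N : Tm l m} → M ⟶ N → Set} {L M N : Tm l m} {σ : L ↠ M} {τ : M ↠ N} →
           Every S σ → Every S τ → Every S (σ ◅◅ τ)
Every-◅◅ ε       q = q
Every-◅◅ (p ◅ q) r = p ◅ Every-◅◅ q r

Every-map : {S T : ∀ {M N : Tm l m} → M ⟶ N → Set} →
            (∀ {M N} {s : M ⟶ N} → S s → T s) →
            {M N : Tm l m} {σ : M ↠ N} → Every S σ → Every T σ
Every-map h ε       = ε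
Every-map h (p ◅ q) = h p ◅ Every-map h q

Every-gmap : {S : ∀ {M N : Tm l m} → M ⟶ N → Set} {T : ∀ {M N : Tm l′ m′} → M ⟶ N → Set}
             {f : Tm l m → Tm l′ m′} {g : ∀ {M N} → M ⟶ N → f M ⟶ f N} →
             (∀ {M N} {s : M ⟶ N} → S s → T (g s)) →
             {M N : Tm l m} {σ : M ↠ N} → Every S σ → Every T (gmap f g σ)
Every-gmap h ε       = ε
Every-gmap h (p ◅ q) = h p ◅ Every-gmap h q

BeforeLast-gmap : {X : Tm l′ m′ → Set} {Y : Tm l m → Set}
                  {f : Tm l m → Tm l′ m′} {g : ∀ {M N} → M ⟶ N → f M ⟶ f N} →
                  (∀ {P} → X (f P) → Y P) →
                  {M N : Tm l m} (σ : M ↠ N) → BeforeLast X (gmap f g σ) → BeforeLast Y σ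
BeforeLast-gmap h ε       _       = _
BeforeLast-gmap h (s ◅ σ) (x , b) = h x , BeforeLast-gmap h σ b

BeforeLast-◅◅ : {X : Tm l m → Set} {L M N : Tm l m} (σ : L ↠ M) {τ : M ↠ N} →
                BeforeLast X (σ ◅◅ τ) → BeforeLast X τ
BeforeLast-◅◅ ε       b       = b
BeforeLast-◅◅ (s ◅ σ) (_ , b) = BeforeLast-◅◅ σ b

Throughout⇒BeforeLast : {X : Tm l m → Set} {M N : Tm l m} (σ : M ↠ N) →
                        Throughout X σ → BeforeLast X σ
Throughout⇒BeforeLast ε       _       = _
Throughout⇒BeforeLast (s ◅ σ) (x , t) = x , Throughout⇒BeforeLast σ t

-- Only the source of a step must not be a θ-redex. The last term is exempt, and in `st-μ-θ` the
-- initial part ends in one.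
LM-μ* : {M N : Tm l (suc m)} {σ : M ↠ N} → BeforeLast (λ P → ¬ θRedex P) (μ* σ) →
        Every LM σ → Every LM (μ* σ)
LM-μ* b        ε       = ε
LM-μ* (¬θ , b) (p ◅ q) = lm-μ ¬θ p ◅ LM-μ* b q

LM-⟦⟧* : {α : Fin m} {M N : Tm l m} {σ : M ↠ N} → BeforeLast (λ P → ¬ ρRedex P) (⟦ α ⟧* σ) →
         Every LM σ → Every LM (⟦ α ⟧* σ)
LM-⟦⟧* b        ε       = ε
LM-⟦⟧* (¬ρ , b) (p ◅ q) = lm-⟦⟧ ¬ρ p ◅ LM-⟦⟧* b q

hd-spine : {M N : Tm l m} {s : M ⟶ N} → Hd s → ∀ Ps → Hd (s ·ˢ Ps)
hd-spine h []       = h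
hd-spine h (P ∷ Ps) = hd-spine (hd-ˡ h) Ps

¬·* : {X : Tm l m → Set} → Rooted X → ∀ {M N} Ps → ¬ X ((M · N) ·* Ps)
¬·* R []       = ¬· R
¬·* R (P ∷ Ps) = ¬·* R Ps

μ-back* : {X : Tm l m → Set} → Rooted X → ∀ {M N} → λμI M → M ↠ N → X (μ N) → X (μ M)
μ-back* R i ε       x = x
μ-back* R i (s ◅ σ) x = μ-back R i s (μ-back* R (I-step i s) σ x)

⟦⟧-back* : {X : Tm l m → Set} → Rooted X → ∀ {α M N} → λμI M → M ↠ N → X (⟦ α ⟧ N) → X (⟦ α ⟧ M)
⟦⟧-back* R i ε       x = x
⟦⟧-back* R i (s ◅ σ) x = ⟦⟧-back R i s (⟦⟧-back* R (I-step i s) σ x)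

-- Such a sequence is empty: its first term has X, and no term before the last may have it.
settled : {X : Tm l m → Set} {M N : Tm l m} (σ : M ↠ N) → X M →
          BeforeLast (λ P → ¬ X P) σ → Every LM σ
settled ε       x b        = ε
settled (s ◅ σ) x (¬x , _) = contradiction x ¬x

-- A standard sequence that passes over the leftmost redex takes no further step at
-- the root, so by rootedness the property would have held before its last term.
arrival : {X : Tm l m → Set} → Rooted X → {M N : Tm l m} {σ : M ↠ N} → λμI M → Standard σ →
          X N → BeforeLast (λ P → ¬ X P) σ → Every LM σ
arrival R i st-ε x b = ε
arrival R i (st-ƛ st) x b = contradiction x (¬ƛ R)
arrival R (I-μ i _) (st-μ {σ = σ} st _) x b = settled (μ* σ) (μ-back* R i σ x) b
-- The initial part is itself an arrival, with the property that prefixing `μ` gives a θ-redex; the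
-- part after the θ-step is an arrival at X.
arrival R (I-μ i p) (st-μ-θ {M′ = M′} {σ′ = σ′} {σ″} b′ st st′) x b = Every-◅◅
  (LM-μ* b′ (arrival θ-rooted i st (_ , refl) (BeforeLast-gmap id σ′ b′)))
  (lm-θ M′ ◅ arrival R (I-step (I-steps (I-μ i p) (μ* σ′)) (θ-red M′)) st′ x
                     (proj₂ (BeforeLast-◅◅ (μ* σ′) b)))
arrival R (I-μ i _) (st-μ-noθ {σ′ = σ′} {σ‴} _ _ _ _) x b =
  settled _ (μ-back* R i (σ′ ◅◅ ⟦ zero ⟧* σ‴) x) b
arrival R (I-⟦⟧ i) (st-⟦⟧ {σ = σ} st _) x b = settled _ (⟦⟧-back* R i σ x) b
arrival R (I-⟦⟧ i) (st-⟦⟧-ρ {α} {M′ = M′} {σ′ = σ′} b′ st st′) x b = Every-◅◅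
  (LM-⟦⟧* b′ (arrival isμ-rooted i st (_ , refl)
    (BeforeLast-gmap (λ { ¬ρ (_ , refl) → ¬ρ (_ , _ , refl) }) σ′ b′)))
  (lm-ρ α M′ ◅ arrival R (I-step (I-steps (I-⟦⟧ i) (⟦ α ⟧* σ′)) (ρ-red α M′)) st′ x
                       (proj₂ (BeforeLast-◅◅ (⟦ α ⟧* σ′) b)))
arrival R (I-⟦⟧ i) (st-⟦⟧-noρ {σ′ = σ′} {σ‴} _ _ _) x b =
  settled _ (⟦⟧-back* R i (σ′ ◅◅ μ* σ‴) x) b
arrival R i (st-β {Ms = Ms} st) x (_ , b) =
  lm-hd (hd-spine hd-β Ms) ◅ arrival R (I-step i (β-red _ _ ·ˢ Ms)) st x b
arrival R i (st-noβ {Ns = Ns} _ _) x b = contradiction x (¬·* R Ns)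
arrival R i (st-μ· {Ms = Ms} st) x (_ , b) =
  lm-hd (hd-spine hd-μ Ms) ◅ arrival R (I-step i (μ-red _ _ ·ˢ Ms)) st x b
arrival R i (st-noμ· {Ns = Ns} _ _) x b = contradiction x (¬·* R Ns)
arrival R i (st-var {Ns = []} [])           x b = ε
arrival R i (st-var {Ns = N ∷ Ns} (_ ∷ _))  x b = contradiction x (¬·* R Ns)

I-·*⁻ : {M : Tm l m} (Ps : List (Tm l m)) → λμI (M ·* Ps) → λμI M × All λμI Ps
I-·*⁻ []       i = i , []
I-·*⁻ (P ∷ Ps) i with I-·*⁻ Ps i
... | I-app j k , ks = j , k ∷ ks

standard⇒LM : {M N : Tm l m} {σ : M ↠ N} → λμI M → Standard σ → NF N → Every LM σ

-- `H′` grows by one argument once that argument has reached its normal form. It thus stays neutral,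
-- which makes the steps in the next argument leftmost.
standards⇒Ar : {H H′ : Tm l m} {Ms Ns : List (Tm l m)} {σ : H ↠ H′} {σs : Pointwise _↠_ Ms Ns} →
               All λμI Ms → Standards σs → NF (H′ ·* Ns) → Ne H′ →
               Every Ar σ → Every Ar (σ ·** σs)
standards⇒Ar is       []                    _ ne e = e
standards⇒Ar (i ∷ is) (_∷_ {Ns = Ns} st sts) n ne e =
  standards⇒Ar is sts n (ne-· ne nfN)
    (Every-◅◅ (Every-gmap ar-ˡ e) (Every-gmap (ar-ʳ ne) (standard⇒LM i st nfN)))
  where
  nfN : NF _
  nfN t = n (ξʳ t ·ˢ Ns)

standard⇒LM i st-ε n = ε
standard⇒LM (I-ƛ i _) (st-ƛ st) n = Every-gmap lm-ƛ (standard⇒LM i st (n ∘ ξƛ))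
standard⇒LM (I-μ i _) (st-μ {σ = σ} st t) n =
  LM-μ* (Throughout⇒BeforeLast (μ* σ) t) (standard⇒LM i st (n ∘ ξμ))
standard⇒LM (I-μ i p) (st-μ-θ {M′ = M′} {σ′ = σ′} b st st′) n = Every-◅◅
  (LM-μ* b (arrival θ-rooted i st (_ , refl) (BeforeLast-gmap id σ′ b)))
  (lm-θ M′ ◅ standard⇒LM (I-step (I-steps (I-μ i p) (μ* σ′)) (θ-red M′)) st′ n)
-- A weakened term reduces only to weakened terms, so the prefix that was passed over is still a
-- θ-redex in the final term.
standard⇒LM i (st-μ-noθ {σ‴ = σ‴} _ (M″ , refl) _ _) n with rename-steps⁻ id suc M″ σ‴
... | N″ , _ , refl = contradiction (θ-red N″) n
standard⇒LM (I-⟦⟧ i) (st-⟦⟧ {α} {σ = σ} st t) n =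
  LM-⟦⟧* (Throughout⇒BeforeLast (⟦ α ⟧* σ) t) (standard⇒LM i st (n ∘ ξ⟦⟧))
standard⇒LM (I-⟦⟧ i) (st-⟦⟧-ρ {α} {M′ = M′} {σ′ = σ′} b st st′) n = Every-◅◅
  (LM-⟦⟧* b (arrival isμ-rooted i st (_ , refl)
    (BeforeLast-gmap (λ { ¬ρ (_ , refl) → ¬ρ (_ , _ , refl) }) σ′ b)))
  (lm-ρ α M′ ◅ standard⇒LM (I-step (I-steps (I-⟦⟧ i) (⟦ α ⟧* σ′)) (ρ-red α M′)) st′ n)
standard⇒LM i (st-⟦⟧-noρ _ _ _) n = contradiction (ρ-red _ _) n
standard⇒LM i (st-β {Ms = Ms} st) n =
  lm-hd (hd-spine hd-β Ms) ◅ standard⇒LM (I-step i (β-red _ _ ·ˢ Ms)) st n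
standard⇒LM i (st-noβ {Ns = Ns} _ _) n = contradiction (β-red _ _ ·ˢ Ns) n
standard⇒LM i (st-μ· {Ms = Ms} st) n =
  lm-hd (hd-spine hd-μ Ms) ◅ standard⇒LM (I-step i (μ-red _ _ ·ˢ Ms)) st n
standard⇒LM i (st-noμ· {Ns = Ns} _ _) n = contradiction (μ-red _ _ ·ˢ Ns) n
standard⇒LM i (st-var {x} {Ms} sts) n =
  Every-map lm-ar (standards⇒Ar (proj₂ (I-·*⁻ Ms i)) sts n (ne-var x) ε)

LM⇒Leftmost : {M N : Tm l m} {σ : M ↠ N} → Every LM σ → Leftmost σ
LM⇒Leftmost ε       = ε
LM⇒Leftmost (p ◅ q) = LM⇒LR p ◅ LM⇒Leftmost q

LM⇒⇓ : {M N : Tm l m} {σ : M ↠ N} → Every LM σ → NF N → M ⇓ ∣ σ ∣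
LM⇒⇓ ε       n = nf n
LM⇒⇓ (p ◅ q) n = step p (LM⇒⇓ q n)

theorem3p23 : ∀ {l m : ℕ} {Γ : Vec Ty l} {Δ : Vec Ty m} {A : Ty} {M N : Tm l m} →
    Γ ∣ Δ ⊢ M ∶ A → λμI M →
    (σ : M ↠ N) → Standard σ → NF N →
    Leftmost σ × (∀ {N′ : Tm l m} (τ : M ↠ N′) → ∣ τ ∣ ≤ ∣ σ ∣)
theorem3p23 _ i σ st n =
  let lms = standard⇒LM i st n in LM⇒Leftmost lms , ⇓-bounds i (LM⇒⇓ lms n)
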